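{- Let $k\in\mathbb N$ and let $G_t$ be a random graph. The following are equivalent: (1) $G_t$ is $\mathcal C_k$-convergent. (2) $G_t$ satisfies probabilistic consistency of the empirical risk with respect to $k$-layer MPNNs.
   Context: Graphs are finite undirected multigraphs (loops and multi-edges allowed); each node $v$ carries a feature $x_v$ from a fixed countable discrete set; isomorphisms preserve features (and roots, for rooted graphs). $N(v)$ is the multiset of neighbors of $v$ (a loop contributes $v$ twice) and $d_v=|N(v)|$. All probability spaces are countable and discrete. A random graph $G_t$ is a stochastic process $\{G_t\}_{t\in\mathbb N}$ where $G_t$ is distributed on graphs with $t$ vertices. Color refinement: for a graph $G$ and node $v$, $\mathsf{cr}_0(v)$ is the rooted tree consisting of a single root with feature $x_v$; $\mathsf{cr}_{k+1}(v)$ is the rooted tree consisting of a root $r$ with feature $x_r=x_v$ and, for each neighbor $w$ of $v$ (with multiplicity), a copy of the tree $\mathsf{cr}_k(w)$ attached to $r$ via an edge to its root. $\mathcal C_k$ is the set of isomorphism classes of rooted trees of the form $\mathsf{cr}_k(v)$ for some graph $G$ and $v\in V(G)$. $\mathcal C_k$-convergence: let $c_{k,t}$ be the random probability mass function (PMF) on $\mathcal C_k$ given by $c_{k,t}(T)=t^{ -1}|\{v\in V(G_t):\mathsf{cr}_k(v)\simeq T\}|$. A sequence of random PMFs $\mu_t$ converges in probability to a PMF $\mu$ if for all outcomes $x$ and all $\varepsilon>0$, $\mathbb P(|\mu_t(x)-\mu(x)|\ge\varepsilon)\to0$ as $t\to\infty$. $G_t$ is $\mathcal C_k$-convergent if there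 is a PMF $c_{k,\infty}$ on $\mathcal C_k$ to which $c_{k,t}$ converges in probability. MPNNs: an $l$-layer message passing graph neural network $f$ is given by arbitrary aggregation and combination functions $\mathsf{agg}_j,\mathsf{comb}_j$ ($1\le j\le l$); on any graph it computes $x_v^{(0)}=x_v$ and $x_v^{(j+1)}=\mathsf{comb}_{j+1}\big(x_v^{(j)},\mathsf{agg}_{j+1}(\{\!\!\{x_w^{(j)}:w\in N(v)\}\!\!\})\big)$ for $0\le j<l$, and its output is $f(v)=x_v^{(l)}$. Probabilistic consistency of the empirical risk with respect to $k$-layer MPNNs: for every node labeling function $f_*$ expressible by a $k$-layer MPNN and every $k$-layer MPNN $f$, with $R_{\mathrm{emp}}(f,G_t)=t^{ -1}|\{v\in V(G_t): f(v)\ne f_*(v)\}|$, the limit $R(f)=\lim_{t\to\infty}\mathbb E[R_{\mathrm{emp}}(f,G_t)]$ exists and for every $\varepsilon>0$, $\mathbb P(|R_{\mathrm{emp}}(f,G_t)-R(f)|\ge\varepsilon)\to0$ as $t\to\infty$. -}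

module Defs where

open import Axiom.ExcludedMiddle using (ExcludedMiddle)
open import Data.Fin using (Fin)
open import Data.Fin.Properties using () renaming (_≟_ to _≟ᶠ_)
open import Data.Integer using (+_)
open import Data.List using (List; []; _∷_; _++_; map; foldr; concatMap; filter; length; lookup; allFin)
open import Data.List.Relation.Binary.Permutation.Propositional using (_↭_)
open import Data.Nat using (ℕ; zero; suc; _⊔_) renaming (_≤_ to _≤ᴺ_)
open import Data.Nat.Properties using (m⊔n≤o⇒m≤o; m⊔n≤o⇒n≤o)
open import Data.Product using (Σ-syntax; ∃-syntax; _×_; _,_; proj₁; proj₂)
open import Data.Rational using (ℚ; 0ℚ; 1ℚ; ½; _/_; _+_; _*_; _-_; -_; ∣_∣; _≤_; _<_; 1/_; Positive; positive)
open import Data.Rational.Properties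
open import Data.Rational.Solver using (module +-*-Solver)
open import Data.Sum using (_⊎_; [_,_]′)
open import Function using (_∘_)
open import Function.Bundles using (_↔_; _↣_; _⇔_; Inverse; Equivalence; mk⇔)
open import Function.Construct.Identity using (↔-id)
open import Function.Construct.Symmetry using (↔-sym)
open import Function.Construct.Composition using (_↔-∘_)
open import Level using (0ℓ)
open import Relation.Binary.Bundles using (Setoid)
open import Relation.Binary.PropositionalEquality using (_≡_; refl; sym; trans; cong; subst; subst₂; setoid)
open import Relation.Nullary using (¬_; does)
open import Data.Bool using (if_then_else_)

import Data.List.Relation.Binary.Subset.Setoid
import Data.List.Relation.Unary.Unique.Setoid

record ℝ : Set where
  constructor mkℝ
  field
    seq    : ℕ → ℚ
    cauchy : ∀ ε → 0ℚ < ε →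
             ∃[ N ] ∀ m n → N ≤ᴺ m → N ≤ᴺ n → ∣ seq m - seq n ∣ ≤ ε
open ℝ public

private
  abstract
    half-pos : ∀ {ε} → 0ℚ < ε → 0ℚ < ½ * ε
    half-pos {ε} 0<ε = subst (_< ½ * ε) (*-zeroʳ ½) (*-monoʳ-<-pos ½ 0<ε)

    half+half : ∀ ε → ½ * ε + ½ * ε ≡ ε
    half+half ε = trans (sym (*-distribʳ-+ ε ½ ½)) (*-identityˡ ε)

    ∣a∣-∣b∣≤∣a-b∣ : ∀ a b → ∣ a ∣ - ∣ b ∣ ≤ ∣ a - b ∣
    ∣a∣-∣b∣≤∣a-b∣ a b = subst₂ _≤_ refl (cancel ∣ a - b ∣ ∣ b ∣)
      (+-monoˡ-≤ (- ∣ b ∣)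
        (subst (λ z → ∣ z ∣ ≤ ∣ a - b ∣ + ∣ b ∣) (restore a b) (∣p+q∣≤∣p∣+∣q∣ (a - b) b)))
      where
      open +-*-Solver
      cancel : ∀ x y → x + y - y ≡ x
      cancel = solve 2 (λ x y → x :+ y :- y := x) refl
      restore : ∀ x y → x - y + y ≡ x
      restore = solve 2 (λ x y → x :- y :+ y := x) refl

    ∣a-b∣≡∣b-a∣ : ∀ a b → ∣ a - b ∣ ≡ ∣ b - a ∣
    ∣a-b∣≡∣b-a∣ a b = trans (sym (∣-p∣≡∣p∣ (a - b))) (cong ∣_∣ (flip a b))
      where
      open +-*-Solver
      flip : ∀ x y → - (x - y) ≡ y - x
      flip = solve 2 (λ x y → :- (x :- y) := y :- x) refl

    ∣∣a∣-∣b∣∣≤∣a-b∣ : ∀ a b → ∣ ∣ a ∣ - ∣ b ∣ ∣ ≤ ∣ a - b ∣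
    ∣∣a∣-∣b∣∣≤∣a-b∣ a b = [ pos , neg ]′ (∣p∣≡p∨∣p∣≡-p (∣ a ∣ - ∣ b ∣))
      where
      open +-*-Solver
      flip : ∀ x y → y - x ≡ - (x - y)
      flip = solve 2 (λ x y → y :- x := :- (x :- y)) refl
      pos : ∣ ∣ a ∣ - ∣ b ∣ ∣ ≡ ∣ a ∣ - ∣ b ∣ → ∣ ∣ a ∣ - ∣ b ∣ ∣ ≤ ∣ a - b ∣
      pos e = subst (_≤ ∣ a - b ∣) (sym e) (∣a∣-∣b∣≤∣a-b∣ a b)
      neg : ∣ ∣ a ∣ - ∣ b ∣ ∣ ≡ - (∣ a ∣ - ∣ b ∣) → ∣ ∣ a ∣ - ∣ b ∣ ∣ ≤ ∣ a - b ∣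
      neg e = subst₂ _≤_ (trans (flip ∣ a ∣ ∣ b ∣) (sym e)) (∣a-b∣≡∣b-a∣ b a) (∣a∣-∣b∣≤∣a-b∣ b a)

    +-step : ∀ {ε} a b c d → ∣ a - c ∣ ≤ ½ * ε → ∣ b - d ∣ ≤ ½ * ε →
             ∣ (a + b) - (c + d) ∣ ≤ ε
    +-step {ε} a b c d p q = subst₂ (λ x y → ∣ x ∣ ≤ y) (sym (regroup a b c d)) (half+half ε)
      (≤-trans (∣p+q∣≤∣p∣+∣q∣ (a - c) (b - d)) (+-mono-≤ p q))
      where
      open +-*-Solver
      regroup : ∀ a b c d → (a + b) - (c + d) ≡ (a - c) + (b - d)
      regroup = solve 4 (λ a b c d → (a :+ b) :- (c :+ d) := (a :- c) :+ (b :- d)) refl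

    bound : ∀ r → ∃[ s ] Positive s × ∣ r ∣ ≤ s
    bound r = ∣ r ∣ + 1ℚ
      , positive (+-mono-≤-< (0≤∣p∣ r) (positive⁻¹ 1ℚ))
      , subst (_≤ ∣ r ∣ + 1ℚ) (+-identityʳ ∣ r ∣) (+-monoʳ-≤ ∣ r ∣ (<⇒≤ (positive⁻¹ 1ℚ)))

    divide : ∀ s → Positive s → ∀ ε → 0ℚ < ε → ∃[ δ ] 0ℚ < δ × s * δ ≡ ε
    divide s s-pos ε 0<ε = s⁻¹ * ε
      , subst (_< s⁻¹ * ε) (*-zeroʳ s⁻¹) (*-monoʳ-<-pos s⁻¹ {{1/pos⇒pos s {{s-pos}}}} 0<ε)
      , trans (sym (*-assoc s s⁻¹ ε))
          (trans (cong (_* ε) (*-inverseʳ s {{pos⇒nonZero s {{s-pos}}}})) (*-identityˡ ε))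
      where
      s⁻¹ : ℚ
      s⁻¹ = (1/ s) {{pos⇒nonZero s {{s-pos}}}}

    ·-step : ∀ r s δ ε a b → Positive s → ∣ r ∣ ≤ s → s * δ ≡ ε → ∣ a - b ∣ ≤ δ →
             ∣ r * a - r * b ∣ ≤ ε
    ·-step r s δ ε a b s-pos r≤s sδ≡ε h = begin
      ∣ r * a - r * b ∣    ≡⟨ cong ∣_∣ (factor r a b) ⟩
      ∣ r * (a - b) ∣      ≡⟨ ∣p*q∣≡∣p∣*∣q∣ r (a - b) ⟩
      ∣ r ∣ * ∣ a - b ∣    ≤⟨ *-monoʳ-≤-nonNeg ∣ a - b ∣ {{∣-∣-nonNeg (a - b)}} r≤s ⟩
      s * ∣ a - b ∣        ≤⟨ *-monoˡ-≤-nonNeg s {{pos⇒nonNeg s {{s-pos}}}} h ⟩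
      s * δ                ≡⟨ sδ≡ε ⟩
      ε                    ∎
      where
      open ≤-Reasoning
      open +-*-Solver
      factor : ∀ r a b → r * a - r * b ≡ r * (a - b)
      factor = solve 3 (λ r a b → r :* a :- r :* b := r :* (a :- b)) refl

    minus-step : ∀ {ε} a b c d → ∣ a - c ∣ ≤ ½ * ε → ∣ b - d ∣ ≤ ½ * ε →
                 ∣ (a - b) - (c - d) ∣ ≤ ε
    minus-step {ε} a b c d p q =
      +-step {ε} a (- b) c (- d) p
        (subst (_≤ ½ * ε) (trans (sym (∣-p∣≡∣p∣ (b - d))) (cong ∣_∣ (flip b d))) q)
      where
      open +-*-Solver
      flip : ∀ x y → - (x - y) ≡ (- x) - (- y)
      flip = solve 2 (λ x y → :- (x :- y) := :- x :- :- y) refl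

    const-step : ∀ {ε} q → 0ℚ < ε → ∣ q - q ∣ ≤ ε
    const-step {ε} q 0<ε = subst (λ z → ∣ z ∣ ≤ ε) (sym (+-inverseʳ q)) (<⇒≤ 0<ε)

infixl 6 _+ℝ_ _-ℝ_
infixr 7 _·ℝ_
infix  4 _≈ℝ_ _≤ℝ_ _<ℝ_

fromℚ : ℚ → ℝ
fromℚ q = mkℝ (λ _ → q) λ ε 0<ε → 0 , λ _ _ _ _ → const-step q 0<ε

0ℝ 1ℝ : ℝ
0ℝ = fromℚ 0ℚ
1ℝ = fromℚ 1ℚ

_+ℝ_ : ℝ → ℝ → ℝ
x +ℝ y = mkℝ (λ n → seq x n + seq y n) λ ε 0<ε →
  let (M , p) = cauchy x (½ * ε) (half-pos 0<ε)
      (N , q) = cauchy y (½ * ε) (half-pos 0<ε)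
  in M ⊔ N , λ m n hm hn →
       +-step (seq x m) (seq y m) (seq x n) (seq y n)
         (p m n (m⊔n≤o⇒m≤o M N hm) (m⊔n≤o⇒m≤o M N hn))
         (q m n (m⊔n≤o⇒n≤o M N hm) (m⊔n≤o⇒n≤o M N hn))

_·ℝ_ : ℚ → ℝ → ℝ
r ·ℝ x = mkℝ (λ n → r * seq x n) λ ε 0<ε →
  let (s , s-pos , r≤s) = bound r
      (δ , 0<δ , sδ≡ε)  = divide s s-pos ε 0<ε
      (N , p)           = cauchy x δ 0<δ
  in N , λ m n hm hn →
       ·-step r s δ ε (seq x m) (seq x n) s-pos r≤s sδ≡ε (p m n hm hn)

_-ℝ_ : ℝ → ℝ → ℝ
x -ℝ y = mkℝ (λ n → seq x n - seq y n) λ ε 0<ε →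
  let (M , p) = cauchy x (½ * ε) (half-pos 0<ε)
      (N , q) = cauchy y (½ * ε) (half-pos 0<ε)
  in M ⊔ N , λ m n hm hn →
       minus-step (seq x m) (seq y m) (seq x n) (seq y n)
         (p m n (m⊔n≤o⇒m≤o M N hm) (m⊔n≤o⇒m≤o M N hn))
         (q m n (m⊔n≤o⇒n≤o M N hm) (m⊔n≤o⇒n≤o M N hn))

∣_∣ℝ : ℝ → ℝ
∣ x ∣ℝ = mkℝ (λ n → ∣ seq x n ∣) λ ε 0<ε →
  let (N , p) = cauchy x ε 0<ε
  in N , λ m n hm hn → ≤-trans (∣∣a∣-∣b∣∣≤∣a-b∣ (seq x m) (seq x n)) (p m n hm hn)

_≤ℝ_ : ℝ → ℝ → Set
x ≤ℝ y = ∀ ε → 0ℚ < ε → ∃[ N ] ∀ n → N ≤ᴺ n → seq x n ≤ seq y n + ε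

_<ℝ_ : ℝ → ℝ → Set
x <ℝ y = ∃[ ε ] 0ℚ < ε × (∃[ N ] ∀ n → N ≤ᴺ n → seq x n + ε ≤ seq y n)

_≈ℝ_ : ℝ → ℝ → Set
x ≈ℝ y = x ≤ℝ y × y ≤ℝ x

infix 4 _⟶_

_⟶_ : (ℕ → ℝ) → ℝ → Set
a ⟶ L = ∀ ε → 0ℝ <ℝ ε → ∃[ N ] ∀ t → N ≤ᴺ t → ∣ a t -ℝ L ∣ℝ <ℝ ε

sumℝ : List ℝ → ℝ
sumℝ = foldr _+ℝ_ 0ℝ

-- HasSum S f s says that the unordered sum of f over the elements of S,
-- counted up to the equality of S, converges to s.
HasSum : (S : Setoid 0ℓ 0ℓ) → (Setoid.Carrier S → ℝ) → ℝ → Set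
HasSum S f s =
  ∀ ε → 0ℝ <ℝ ε →
  ∃[ L ] Unique L ×
    (∀ L′ → Unique L′ → L ⊆ L′ → ∣ sumℝ (map f L′) -ℝ s ∣ℝ <ℝ ε)
  where
  open Data.List.Relation.Unary.Unique.Setoid S using (Unique)
  open Data.List.Relation.Binary.Subset.Setoid S using (_⊆_)

record PMF (S : Setoid 0ℓ 0ℓ) : Set where
  open Setoid S
  field
    mass      : Carrier → ℝ
    mass-cong : ∀ {x y} → x ≈ y → mass x ≈ℝ mass y
    mass≥0    : ∀ x → 0ℝ ≤ℝ mass x
    mass-sum  : HasSum S mass 1ℝ
open PMF public

record ProbabilitySpace : Set₁ where
  field
    Ω         : Set
    countable : Ω ↣ ℕ
    ℙ         : PMF (setoid Ω)
open ProbabilitySpace public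

-- Every random variable below is an indicator or a fraction of the nodes of a
-- finite graph, so rational-valued random variables are all that is needed.
IsExpectation : (P : ProbabilitySpace) → (Ω P → ℚ) → ℝ → Set
IsExpectation P Y e = HasSum (setoid (Ω P)) (λ ω → Y ω ·ℝ mass (ℙ P) ω) e

-- The two endpoints of an edge are listed in an arbitrary order; repeated
-- entries of the list are parallel edges.
record Graph (X : Set) (t : ℕ) : Set where
  field
    feature : Fin t → X
    edges   : List (Fin t × Fin t)
open Graph public

otherEnds : ∀ {t} → Fin t → Fin t × Fin t → List (Fin t)
otherEnds v (a , b) =
  (if does (a ≟ᶠ v) then b ∷ [] else []) ++ (if does (b ≟ᶠ v) then a ∷ [] else [])

-- The multiset N(v), listed in an arbitrary order.
neighbors : ∀ {X t} → Graph X t → Fin t → List (Fin t)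
neighbors G v = concatMap (otherEnds v) (edges G)

-- The order in which the subtrees of a node are listed is disregarded by _≅_.
data Tree (X : Set) : Set where
  node : X → List (Tree X) → Tree X

data Node {X : Set} : Tree X → Set where
  root  : ∀ {T} → Node T
  below : ∀ {x Ts} (i : Fin (length Ts)) → Node (lookup Ts i) → Node (node x Ts)

nodeFeature : ∀ {X} {T : Tree X} → Node T → X
nodeFeature {T = node x _} root = x
nodeFeature (below i p)         = nodeFeature p

data Parent {X : Set} : {T : Tree X} → Node T → Node T → Set where
  top    : ∀ {x Ts} {i : Fin (length Ts)} →
           Parent {T = node x Ts} root (below i root)
  deeper : ∀ {x Ts} {i : Fin (length Ts)} {p q : Node (lookup Ts i)} →
           Parent p q → Parent {T = node x Ts} (below i p) (below i q)

Adjacent : ∀ {X} {T : Tree X} → Node T → Node T → Set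
Adjacent p q = Parent p q ⊎ Parent q p

infix 4 _≅_

record _≅_ {X : Set} (T U : Tree X) : Set where
  field
    bijection : Node T ↔ Node U
  open Inverse bijection public using (to; from)
  field
    to-root     : to root ≡ root
    to-feature  : ∀ p → nodeFeature (to p) ≡ nodeFeature p
    to-adjacent : ∀ p q → Adjacent p q ⇔ Adjacent (to p) (to q)

≅-refl : ∀ {X} {T : Tree X} → T ≅ T
≅-refl = record
  { bijection   = ↔-id _
  ; to-root     = refl
  ; to-feature  = λ _ → refl
  ; to-adjacent = λ _ _ → mk⇔ (λ a → a) (λ a → a)
  }

≅-sym : ∀ {X} {T U : Tree X} → T ≅ U → U ≅ T
≅-sym e = record
  { bijection   = ↔-sym bijection
  ; to-root     = trans (cong from (sym to-root)) (strictlyInverseʳ root)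
  ; to-feature  = λ p → trans (sym (to-feature (from p))) (cong nodeFeature (strictlyInverseˡ p))
  ; to-adjacent = λ p q → mk⇔
      (λ a → Equivalence.from (to-adjacent (from p) (from q))
        (subst₂ Adjacent (sym (strictlyInverseˡ p)) (sym (strictlyInverseˡ q)) a))
      (λ a → subst₂ Adjacent (strictlyInverseˡ p) (strictlyInverseˡ q)
        (Equivalence.to (to-adjacent (from p) (from q)) a))
  }
  where
  open _≅_ e
  open Inverse bijection using (strictlyInverseˡ; strictlyInverseʳ)

≅-trans : ∀ {X} {T U V : Tree X} → T ≅ U → U ≅ V → T ≅ V
≅-trans e f = record
  { bijection   = F.bijection ↔-∘ E.bijection
  ; to-root     = trans (cong F.to E.to-root) F.to-root
  ; to-feature  = λ p → trans (F.to-feature (E.to p)) (E.to-feature p)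
  ; to-adjacent = λ p q → mk⇔
      (Equivalence.to (F.to-adjacent _ _) ∘ Equivalence.to (E.to-adjacent p q))
      (Equivalence.from (E.to-adjacent p q) ∘ Equivalence.from (F.to-adjacent _ _))
  }
  where
  module E = _≅_ e
  module F = _≅_ f

cr : ∀ {X t} → ℕ → Graph X t → Fin t → Tree X
cr zero    G v = node (feature G v) []
cr (suc k) G v = node (feature G v) (map (cr k G) (neighbors G v))

𝒞 : Set → ℕ → Setoid 0ℓ 0ℓ
𝒞 X k = record
  { Carrier       = Σ[ T ∈ Tree X ] ∃[ t ] Σ[ G ∈ Graph X t ] ∃[ v ] T ≡ cr k G v
  ; _≈_           = λ S T → proj₁ S ≅ proj₁ T
  ; isEquivalence = record { refl = ≅-refl ; sym = ≅-sym ; trans = ≅-trans }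
  }

-- MPNN X l A: l-layer networks with input features in X and outputs in A.
-- agg is a function of multisets: a function of lists invariant under
-- permutation.
-- The only 0-layer network is v ↦ x_v, so consistency with respect to
-- 0-layer networks is vacuous and the number of layers of interest is ≥ 1.
data MPNN (X : Set) : ℕ → Set → Set₁ where
  input : MPNN X 0 X
  layer : ∀ {l A M B} → MPNN X l A →
          (agg : List A → M) → (∀ {xs ys} → xs ↭ ys → agg xs ≡ agg ys) →
          (comb : A → M → B) →
          MPNN X (suc l) B

eval : ∀ {X l A t} → MPNN X l A → Graph X t → Fin t → A
eval input                G v = feature G v
eval (layer f agg _ comb) G v = comb (eval f G v) (agg (map (eval f G) (neighbors G v)))

NodeLabeling : Set → Set → Set
NodeLabeling X A = ∀ {t} → Graph X t → Fin t → A

Expressible : ∀ {X A} → ℕ → NodeLabeling X A → Set₁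
Expressible {X} {A} k f* =
  Σ[ g ∈ MPNN X k A ] (∀ {t} (G : Graph X t) v → f* G v ≡ eval g G v)

record RandomGraph (X : Set) (t : ℕ) : Set₁ where
  field
    space : ProbabilitySpace
    graph : Ω space → Graph X t
open RandomGraph public

-- The notions below depend only on the law of each G_t, so the G_t need not
-- live on a common probability space; a process on a common countable space
-- is the case where space (G t) is constant in t.
RandomGraphProcess : Set → Set₁
RandomGraphProcess X = ∀ t → RandomGraph X t

-- Excluded middle is used to count nodes with an arbitrary property and to
-- form indicators of arbitrary events.
module Classical (em : ExcludedMiddle 0ℓ) where

  -- t⁻¹ |{v : A v}|; the value for t = 0 is a convention with no effect on
  -- limits as t → ∞.
  fraction : ∀ {t} → (Fin t → Set) → ℚ
  fraction {zero}  A = 0ℚ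
  fraction {suc t} A = + length (filter (λ v → em {A v}) (allFin (suc t))) / suc t

  indicator : ∀ {Ω : Set} → (Ω → Set) → Ω → ℚ
  indicator A ω = if does (em {A ω}) then 1ℚ else 0ℚ

  IsProbability : (P : ProbabilitySpace) → (Ω P → Set) → ℝ → Set
  IsProbability P A = IsExpectation P (indicator A)

  ConvergesInProbability : (P : ℕ → ProbabilitySpace) → (∀ t → Ω (P t) → ℚ) → ℝ → Set
  ConvergesInProbability P Y y =
    ∀ ε → 0ℝ <ℝ ε →
    ∃[ p ] (∀ t → IsProbability (P t) (λ ω → ε ≤ℝ ∣ fromℚ (Y t ω) -ℝ y ∣ℝ) (p t)) ×
           p ⟶ 0ℝ

  module _ {X : Set} (G : RandomGraphProcess X) where

    P : ℕ → ProbabilitySpace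
    P t = space (G t)

    c : ∀ k t → Setoid.Carrier (𝒞 X k) → Ω (P t) → ℚ
    c k t T ω = fraction (λ v → cr k (graph (G t) ω) v ≅ proj₁ T)

    𝒞-Convergent : ℕ → Set
    𝒞-Convergent k =
      Σ[ c∞ ∈ PMF (𝒞 X k) ]
        (∀ T → ConvergesInProbability P (λ t → c k t T) (mass c∞ T))

    Remp : ∀ {k A} → NodeLabeling X A → MPNN X k A → ∀ t → Ω (P t) → ℚ
    Remp f* f t ω =
      fraction (λ v → ¬ (eval f (graph (G t) ω) v ≡ f* (graph (G t) ω) v))

    Consistent : ℕ → Set₁
    Consistent k =
      ∀ {A : Set} (f* : NodeLabeling X A) → Expressible k f* → (f : MPNN X k A) →
      ∃[ R ] (∃[ E ] (∀ t → IsExpectation (P t) (Remp f* f t) (E t)) × E ⟶ R) ×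
             ConvergesInProbability P (Remp f* f) R

{-# OPTIONS --safe #-}
-- The rooted trees are encoded by natural numbers, in such a way that equal codes mean isomorphic
-- trees and a k-layer network can compute the code of cr_k(v).  For k ≥ 1 the k-layer networks
-- therefore compute exactly the functions of cr_k(v) up to isomorphism, and consistency says that
-- for every set A of trees the fraction of nodes v with cr_k(v) ∈ A converges in probability and
-- in mean.
--
-- If G is 𝒞_k-convergent, a finite set of trees carries almost all of the mass of the limit.  The
-- fractions of A and of its complement are bounded below by their parts in this finite set, and
-- they add up to at most 1, so the fraction of A converges (Scheffé's argument).
--
-- Conversely, the limits for the singletons A form a sub-probability distribution, and the only
-- issue is that no mass may escape to infinity.  As the expected fraction converges for every set
-- A, a gliding hump argument excludes such an escape.
module Submission where

open import Defs
open import Axiom.ExcludedMiddle using (ExcludedMiddle)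
open import Data.Bool using (Bool; true; false)
open import Data.Empty using (⊥; ⊥-elim)
open import Data.Fin using (Fin; zero; suc; cast)
import Data.Fin.Properties as Finₚ
open import Data.Fin.Permutation using (cast-id)
open import Data.Integer as ℤ using (+_; +[1+_]; -[1+_])
import Data.Integer.Properties as ℤₚ
open import Data.List using (List; []; _∷_; _++_; map; length; lookup; foldr; filter; concatMap; allFin; deduplicate)
open import Data.List.Extrema.Nat using (max; xs≤max)
open import Data.List.Membership.Propositional using (_∈_; lose)
open import Data.List.Membership.Propositional.Properties using (∈-lookup; ∈-concatMap⁺; ∈-map⁺; ∈-allFin)
import Data.List.Membership.Setoid
import Data.List.Membership.Setoid.Properties as Membershipₚ
open import Data.List.Properties using (length-map; map-∘; map-cong;
  ∷-injectiveˡ; ∷-injectiveʳ; filter-none; filter-all; length-tabulate)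
open import Data.List.Relation.Binary.BagAndSetEquality using (∼bag⇒↭)
open import Data.List.Relation.Binary.Permutation.Homogeneous using (onIndices)
open import Data.List.Relation.Binary.Permutation.Propositional using (_↭_; ↭-refl; ↭-trans; ↭-sym; ↭-reflexive; ↭⇒↭ₛ)
open import Data.List.Relation.Binary.Permutation.Propositional.Properties using (map⁺)
import Data.List.Relation.Binary.Permutation.Setoid.Properties as PermutationSetoid
import Data.List.Relation.Binary.Pointwise as Pointwise
import Data.List.Relation.Binary.Subset.Setoid
open import Data.List.Relation.Unary.All as All using (All; []; _∷_)
open import Data.List.Relation.Unary.AllPairs as AllPairs using (AllPairs; []; _∷_)
open import Data.List.Relation.Unary.Any as Any using (Any; here; there; index)
open import Data.List.Relation.Unary.Any.Properties using (lookup-index)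
open import Data.List.Relation.Unary.Sorted.TotalOrder.Properties using (↗↭↗⇒≋)
import Data.List.Relation.Unary.Unique.DecSetoid.Properties as DecUnique
import Data.List.Relation.Unary.Unique.Setoid
open import Data.Nat as ℕ using (ℕ; zero; suc; _≤_; _<_; s≤s; z≤n; _*_; _⊔_)
import Data.Nat.Properties as ℕₚ
open import Data.List.Sort ℕₚ.≤-decTotalOrder using (sort; sort-↭; sort-↗)
open import Data.Product using (∃; Σ-syntax; ∃-syntax; _×_; _,_; proj₁; proj₂; map₂)
open import Data.Rational as ℚ using (ℚ; 0ℚ; 1ℚ; ½; _/_; mkℚ)
import Data.Rational.Properties as ℚₚ
open import Data.Rational.Solver using (module +-*-Solver)
open +-*-Solver using (solve; _:=_; _:+_; _:*_; _:-_; :-_; con)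
open import Data.Rational.Unnormalised as ℚᵘ using (mkℚᵘ)
import Data.Rational.Unnormalised.Properties as ℚᵘₚ
open import Data.Sum as Sum using (_⊎_; inj₁; inj₂; [_,_]′)
open import Data.Unit using (⊤; tt)
open import Function using (_∘_)
open import Function.Bundles using (_↔_; _↣_; _⇔_; Inverse; Injection; Equivalence; mk⇔; mk↔ₛ′; mk⤖)
open import Function.Consequences.Propositional using (strictlySurjective⇒surjective)
open import Function.Construct.Composition using (_↔-∘_)
open import Function.Construct.Symmetry using (↔-sym)
open import Function.Properties.Bijection using (⤖⇒↔)
open import Level using (0ℓ)
open import Relation.Binary.Bundles using (Setoid; DecSetoid)
open import Relation.Binary.PropositionalEquality using (_≡_; refl; sym; trans; cong; cong₂; subst; subst₂; setoid)
open import Relation.Nullary using (¬_; yes; no; does)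
open import Relation.Nullary.Decidable using (dec-true)

-- Convergence on single trees alone permits an escape: if all nodes of the graph at time t carry
-- the same tree, a new one for each t, every single tree has limit 0. What forbids this is that
-- `comb` is arbitrary, so that consistency applies to every set of codes, even to one built from
-- the process itself. The argument is the one behind Nikodym's convergence theorem and Schur's
-- property of ℓ¹. The limit set function is a priori only finitely additive, and its value on a
-- half-line says nothing about where the mass sits; the humps are therefore located at finite
-- times. There the mass is tight, because a countable probability space is almost carried by
-- finitely many outcomes. Codes in ℕ serve twice: networks can compute them, and their order gives
-- a meaning to tails and blocks. On the side of trees, the obstacle is that `_≅_` preserves the
-- root, the features and undirected adjacency only, so the direction of the edges has to be
-- recovered before an isomorphism restricts to subtrees.

-- Permutations of lists as bijections of indices

index-injective : ∀ {A : Set} {v : A} {xs} (m m′ : v ∈ xs) → index m ≡ index m′ → m ≡ m′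
index-injective (here refl) (here refl) _ = refl
index-injective (there m) (there m′) e = cong there (index-injective m m′ (Finₚ.suc-injective e))

index-∈-lookup : ∀ {A : Set} (xs : List A) i → index (∈-lookup {xs = xs} i) ≡ i
index-∈-lookup (x ∷ xs) zero    = refl
index-∈-lookup (x ∷ xs) (suc i) = cong suc (index-∈-lookup xs i)

∈-at : ∀ {A : Set} {v : A} xs i → v ≡ lookup xs i → Σ[ m ∈ v ∈ xs ] index m ≡ i
∈-at xs i refl = ∈-lookup i , index-∈-lookup xs i

-- A permutation amounts to a bijection between the proofs of `v ∈ xs` and of `v ∈ ys` for each `v`.
-- Such a proof is determined by its index, so both inverse laws reduce to those of `σ`.
indices⇒↭ : ∀ {A : Set} {xs ys : List A} (σ : Fin (length xs) ↔ Fin (length ys)) →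
            (∀ i → lookup xs i ≡ lookup ys (Inverse.to σ i)) → xs ↭ ys
indices⇒↭ {A} {xs} {ys} σ eq = ∼bag⇒↭ λ {v} → mk↔ₛ′ (proj₁ ∘ forth) (proj₁ ∘ back)
    (λ m → index-injective _ _ (trans (proj₂ (forth (proj₁ (back m))))
             (trans (cong to (proj₂ (back m))) (strictlyInverseˡ (index m)))))
    (λ m → index-injective _ _ (trans (proj₂ (back (proj₁ (forth m))))
             (trans (cong from (proj₂ (forth m))) (strictlyInverseʳ (index m)))))
  where
  open Inverse σ
  forth : ∀ {v} (m : v ∈ xs) → Σ[ m′ ∈ v ∈ ys ] index m′ ≡ to (index m)
  forth m = ∈-at ys _ (trans (lookup-index m) (eq (index m)))
  back : ∀ {v} (m : v ∈ ys) → Σ[ m′ ∈ v ∈ xs ] index m′ ≡ from (index m)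
  back m = ∈-at xs _ (trans (lookup-index m)
    (trans (cong (lookup ys) (sym (strictlyInverseˡ (index m)))) (sym (eq (from (index m))))))

mapIndex : ∀ {A B : Set} (f : A → B) xs → Fin (length xs) ↔ Fin (length (map f xs))
mapIndex f xs = cast-id (sym (length-map f xs))

lookup-mapIndex : ∀ {A B : Set} (f : A → B) xs i →
                  lookup (map f xs) (Inverse.to (mapIndex f xs) i) ≡ f (lookup xs i)
lookup-mapIndex f xs i = go f xs _ i
  where
  go : ∀ {A B : Set} (f : A → B) xs .(e : length xs ≡ length (map f xs)) i →
       lookup (map f xs) (cast e i) ≡ f (lookup xs i)
  go f (x ∷ xs) e zero    = refl
  go f (x ∷ xs) e (suc i) = go f xs _ i

↭⇒indices : ∀ {A : Set} {xs ys : List A} → xs ↭ ys →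
            Σ[ σ ∈ Fin (length xs) ↔ Fin (length ys) ] (∀ i → lookup xs i ≡ lookup ys (Inverse.to σ i))
↭⇒indices {A} p = onIndices (↭⇒↭ₛ p) , PermutationSetoid.onIndices-lookup (setoid A) (↭⇒↭ₛ p)

module _ {A B C : Set} (f : A → C) (g : B → C) {xs : List A} {ys : List B} where

  -- The domains of `f` and `g` differ because nodes of two graphs are to be compared: equal
  -- multisets of colours yield a matching of the neighbours themselves, along which other functions
  -- can be transported.
  map-↭⇒indices : map f xs ↭ map g ys →
    Σ[ σ ∈ Fin (length xs) ↔ Fin (length ys) ] (∀ i → f (lookup xs i) ≡ g (lookup ys (Inverse.to σ i)))
  map-↭⇒indices p = σ , λ i →
    trans (sym (lookup-mapIndex f xs i))
      (trans (proj₂ τ _)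
      (trans (cong (lookup (map g ys)) (sym (Inverse.strictlyInverseˡ (mapIndex g ys) _)))
        (lookup-mapIndex g ys _)))
    where
    τ = ↭⇒indices p
    σ = ↔-sym (mapIndex g ys) ↔-∘ (proj₁ τ ↔-∘ mapIndex f xs)

  indices⇒map-↭ : (σ : Fin (length xs) ↔ Fin (length ys)) →
    (∀ i → f (lookup xs i) ≡ g (lookup ys (Inverse.to σ i))) → map f xs ↭ map g ys
  indices⇒map-↭ σ eq = indices⇒↭ (mapIndex g ys ↔-∘ (σ ↔-∘ ↔-sym (mapIndex f xs))) λ i →
    trans (cong (lookup (map f xs)) (sym (Inverse.strictlyInverseˡ (mapIndex f xs) i)))
      (trans (lookup-mapIndex f xs _) (trans (eq _) (sym (lookup-mapIndex g ys _))))

-- Isomorphisms of rooted trees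

depth : ∀ {X} {T : Tree X} → Node T → ℕ
depth root        = 0
depth (below _ p) = suc (depth p)

Parent-depth : ∀ {X} {T : Tree X} {p q : Node T} → Parent p q → depth q ≡ suc (depth p)
Parent-depth top        = refl
Parent-depth (deeper a) = cong suc (Parent-depth a)

Parent-unique : ∀ {X} {T : Tree X} {p q r : Node T} → Parent p r → Parent q r → p ≡ q
Parent-unique top        top        = refl
Parent-unique (deeper a) (deeper b) = cong (below _) (Parent-unique a b)

root⊎child : ∀ {X} {T : Tree X} (p : Node T) → p ≡ root ⊎ (∃[ q ] Parent q p)
root⊎child root = inj₁ refl
root⊎child (below i p) with root⊎child p
... | inj₁ refl    = inj₂ (root , top)
... | inj₂ (q , a) = inj₂ (below i q , deeper a)

¬Parent-root : ∀ {X} {T : Tree X} {p q : Node T} → q ≡ root → Parent p q → ⊥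
¬Parent-root refl ()

below-injectiveˡ : ∀ {X} {x : X} {Ts i j} {p : Node (lookup Ts i)} {q : Node (lookup Ts j)} →
                   below {x = x} {Ts} i p ≡ below j q → i ≡ j
below-injectiveˡ refl = refl

below-injectiveʳ : ∀ {X} {x : X} {Ts i} {p q : Node (lookup Ts i)} →
                   below {x = x} {Ts} i p ≡ below i q → p ≡ q
below-injectiveʳ refl = refl

root-child : ∀ {X} {x : X} {Ts} {p q : Node (node x Ts)} → p ≡ root → Parent p q → ∃[ j ] q ≡ below j root
root-child refl (top {i = i}) = i , refl

Parent-branch : ∀ {X} {x : X} {Ts j} {p : Node (lookup Ts j)} {q r : Node (node x Ts)} →
                q ≡ below j p → Parent q r → ∃[ p′ ] r ≡ below j p′
Parent-branch refl (deeper {q = q} _) = q , refl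

Parent-below⁻ : ∀ {X} {x : X} {Ts i} {p q : Node (lookup Ts i)} →
                Parent {T = node x Ts} (below i p) (below i q) → Parent p q
Parent-below⁻ (deeper a) = a

module _ {X : Set} {T U : Tree X} (e : T ≅ U) where
  open _≅_ e
  open Inverse bijection using (strictlyInverseʳ)

  to-injective : ∀ {p q} → to p ≡ to q → p ≡ q
  to-injective {p} {q} eq = trans (sym (strictlyInverseʳ p)) (trans (cong from eq) (strictlyInverseʳ q))

  -- The root fixes the orientation of the edges. A reversed edge would make `to q` a parent of
  -- `to p`; but the root has no parent, and any other `p` has a parent which, by induction on
  -- depth, is also mapped to a parent of `to p`.
  to-parent : ∀ {p q} → Parent p q → Parent (to p) (to q)
  to-parent {p} a = go _ p refl a
    where
    go : ∀ n p {q} → depth p ≡ n → Parent p q → Parent (to p) (to q)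
    go n p {q} d a with Equivalence.to (to-adjacent p q) (inj₁ a) | root⊎child p
    ... | inj₁ b | _ = b
    ... | inj₂ b | inj₁ refl = ⊥-elim (¬Parent-root to-root b)
    go zero p d a | inj₂ b | inj₂ (p₀ , a₀) with () ← trans (sym d) (Parent-depth a₀)
    -- Parents are unique, so `q` would be the parent `p₀` of `p`, hence both one level below and
    -- one level above `p`.
    go (suc n) p {q} d a | inj₂ b | inj₂ (p₀ , a₀)
      with refl ← to-injective (Parent-unique b (go n p₀ (ℕₚ.suc-injective (trans (sym (Parent-depth a₀)) d)) a₀))
      = ⊥-elim (ℕₚ.m≢1+n+m (depth q) {1} (trans (Parent-depth a) (cong suc (Parent-depth a₀))))

to-parent⁻ : ∀ {X} {T U : Tree X} (e : T ≅ U) {p q} →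
             Parent (_≅_.to e p) (_≅_.to e q) → Parent p q
to-parent⁻ e {p} {q} a = subst₂ Parent (strictlyInverseʳ p) (strictlyInverseʳ q) (to-parent (≅-sym e) a)
  where
  open _≅_ e
  open Inverse bijection using (strictlyInverseʳ)

module Restrict {X : Set} {x y : X} {Ts Us : List (Tree X)} (e : node x Ts ≅ node y Us) where
  open _≅_ e

  child : ∀ i → ∃[ j ] to (below i root) ≡ below j root
  child i = root-child to-root (to-parent e top)

  σ : Fin (length Ts) → Fin (length Us)
  σ i = proj₁ (child i)

  branch : ∀ i (p : Node (lookup Ts i)) → ∃[ q ] to (below i p) ≡ below (σ i) q
  branch i p = go _ p refl
    where
    go : ∀ n p → depth p ≡ n → ∃[ q ] to (below i p) ≡ below (σ i) q
    go n p d with root⊎child p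
    ... | inj₁ refl = root , proj₂ (child i)
    go zero p d    | inj₂ (p₀ , a) with () ← trans (sym d) (Parent-depth a)
    go (suc n) p d | inj₂ (p₀ , a) =
      Parent-branch (proj₂ (go n p₀ (ℕₚ.suc-injective (trans (sym (Parent-depth a)) d))))
        (to-parent e (deeper a))

module _ {X : Set} {x y : X} {Ts Us : List (Tree X)} (e : node x Ts ≅ node y Us) where
  private
    module E = _≅_ e
    open Inverse E.bijection using (strictlyInverseʳ; strictlyInverseˡ)
    module F = Restrict e
    module B = Restrict (≅-sym e)

    σ-inverse : ∀ i → B.σ (F.σ i) ≡ i
    σ-inverse i = below-injectiveˡ (trans (sym (proj₂ (B.child (F.σ i))))
      (trans (cong E.from (sym (proj₂ (F.child i)))) (strictlyInverseʳ _)))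

    σ-inverse′ : ∀ j → F.σ (B.σ j) ≡ j
    σ-inverse′ j = below-injectiveˡ (trans (sym (proj₂ (F.child (B.σ j))))
      (trans (cong E.to (sym (proj₂ (B.child j)))) (strictlyInverseˡ _)))

    -- The inverse isomorphism lands a priori in the branch `B.σ (F.σ i)`; the transport renames it
    -- to `i`, so that it can invert `F.branch i`.
    branch⁻ : ∀ i (q : Node (lookup Us (F.σ i))) → ∃[ p ] E.from (below (F.σ i) q) ≡ below i p
    branch⁻ i q = subst (λ j → Σ[ p ∈ Node (lookup Ts j) ] E.from (below (F.σ i) q) ≡ below j p)
      (σ-inverse i) (B.branch (F.σ i) q)

    to-branch : ∀ i (p : Node (lookup Ts i)) → E.to (below i p) ≡ below (F.σ i) (proj₁ (F.branch i p))
    to-branch i p = proj₂ (F.branch i p)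

  root-feature : x ≡ y
  root-feature = trans (sym (E.to-feature root)) (cong nodeFeature E.to-root)

  childIndices : Fin (length Ts) ↔ Fin (length Us)
  childIndices = mk↔ₛ′ F.σ B.σ σ-inverse′ σ-inverse

  subtree : ∀ i → lookup Ts i ≅ lookup Us (Inverse.to childIndices i)
  subtree i = record
    { bijection   = mk↔ₛ′ (proj₁ ∘ F.branch i) (proj₁ ∘ branch⁻ i)
        (λ q → below-injectiveʳ (trans (sym (to-branch i _))
          (trans (cong E.to (sym (proj₂ (branch⁻ i q)))) (strictlyInverseˡ _))))
        (λ p → below-injectiveʳ (trans (sym (proj₂ (branch⁻ i _)))
          (trans (cong E.from (sym (to-branch i p))) (strictlyInverseʳ _))))
    ; to-root     = below-injectiveʳ (trans (sym (to-branch i root)) (proj₂ (F.child i)))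
    ; to-feature  = λ p → trans (cong nodeFeature (sym (to-branch i p))) (E.to-feature (below i p))
    ; to-adjacent = λ p q → mk⇔
        (λ { (inj₁ a) → inj₁ (forth a) ; (inj₂ a) → inj₂ (forth a) })
        (λ { (inj₁ a) → inj₁ (back a) ; (inj₂ a) → inj₂ (back a) })
    }
    where
    forth : ∀ {p q} → Parent p q → Parent (proj₁ (F.branch i p)) (proj₁ (F.branch i q))
    forth a = Parent-below⁻ (subst₂ Parent (to-branch i _) (to-branch i _) (to-parent e (deeper a)))
    back : ∀ {p q} → Parent (proj₁ (F.branch i p)) (proj₁ (F.branch i q)) → Parent p q
    back a = Parent-below⁻ (to-parent⁻ e (subst₂ Parent (sym (to-branch i _)) (sym (to-branch i _)) (deeper a)))

module _ {X : Set} {x : X} {Ts Us : List (Tree X)} (σ : Fin (length Ts) ↔ Fin (length Us))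
         (e : ∀ i → lookup Ts i ≅ lookup Us (Inverse.to σ i)) where
  private
    to : Node (node x Ts) → Node (node x Us)
    to root        = root
    to (below i p) = below (Inverse.to σ i) (_≅_.to (e i) p)

    σ-injective : ∀ {i j} → Inverse.to σ i ≡ Inverse.to σ j → i ≡ j
    σ-injective {i} {j} eq = trans (sym (Inverse.strictlyInverseʳ σ i))
      (trans (cong (Inverse.from σ) eq) (Inverse.strictlyInverseʳ σ j))

    injective : ∀ {p q} → to p ≡ to q → p ≡ q
    injective {root}      {root}      _ = refl
    injective {below i p} {below j q} eq with refl ← σ-injective (below-injectiveˡ eq) =
      cong (below i) (to-injective (e i) (below-injectiveʳ eq))

    surjective : ∀ q → ∃[ p ] to p ≡ q
    surjective root = root , refl
    surjective (below j q) = go (Inverse.from σ j) (Inverse.strictlyInverseˡ σ j) q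
      where
      -- `Inverse.to σ (Inverse.from σ j)` is only propositionally `j`; with `j` a variable the
      -- equation can be matched away.
      go : ∀ i {j} → Inverse.to σ i ≡ j → (q : Node (lookup Us j)) → ∃[ p ] to p ≡ below j q
      go i refl q = below i (_≅_.from (e i) q)
                  , cong (below _) (Inverse.strictlyInverseˡ (_≅_.bijection (e i)) q)

    forth : ∀ {p q} → Parent p q → Parent (to p) (to q)
    forth (top {i = i}) = subst (λ r → Parent root (below _ r)) (sym (_≅_.to-root (e i))) top
    forth (deeper a)    = deeper (to-parent (e _) a)

    back : ∀ p q → Parent (to p) (to q) → Parent p q
    back root        root        ()
    back (below i p) root        ()
    back root        (below i q) a with _ , eq ← root-child refl a with refl ← below-injectiveˡ eq
      with refl ← to-injective (e i) (trans (below-injectiveʳ eq) (sym (_≅_.to-root (e i)))) = top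
    back (below i p) (below j q) a with _ , eq ← Parent-branch refl a
      with refl ← σ-injective (below-injectiveˡ eq) = deeper (to-parent⁻ (e i) (Parent-below⁻ a))

  node-≅ : node x Ts ≅ node x Us
  node-≅ = record
    { bijection   = ⤖⇒↔ (mk⤖ {to = to} (injective , strictlySurjective⇒surjective surjective))
    ; to-root     = refl
    ; to-feature  = λ { root → refl ; (below i p) → _≅_.to-feature (e i) p }
    ; to-adjacent = λ p q → mk⇔
        (λ { (inj₁ a) → inj₁ (forth a) ; (inj₂ a) → inj₂ (forth a) })
        (λ { (inj₁ a) → inj₁ (back _ _ a) ; (inj₂ a) → inj₂ (back _ _ a) })
    }

-- Canonical forms and codes for multisets of natural numbers

sort-cong : ∀ {xs ys} → xs ↭ ys → sort xs ≡ sort ys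
sort-cong {xs} {ys} p = Pointwise.Pointwise-≡⇒≡
  (↗↭↗⇒≋ ℕₚ.≤-totalOrder (sort-↗ xs) (sort-↗ ys)
    (↭⇒↭ₛ (↭-trans (sort-↭ xs) (↭-trans p (↭-sym (sort-↭ ys))))))

sort-reflects : ∀ {xs ys} → sort xs ≡ sort ys → xs ↭ ys
sort-reflects {xs} {ys} eq = ↭-trans (↭-sym (sort-↭ xs)) (↭-trans (↭-reflexive eq) (sort-↭ ys))

2^_·odd_ : ℕ → ℕ → ℕ
2^ zero  ·odd b = suc (2 * b)
2^ suc a ·odd b = 2 * (2^ a ·odd b)

2^·odd-injective : ∀ a b c d → 2^ a ·odd b ≡ 2^ c ·odd d → a ≡ c × b ≡ d
2^·odd-injective zero    b zero    d e = refl , ℕₚ.*-cancelˡ-≡ b d 2 (ℕₚ.suc-injective e)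
2^·odd-injective zero    b (suc c) d e = ⊥-elim (ℕₚ.even≢odd (2^ c ·odd d) b (sym e))
2^·odd-injective (suc a) b zero    d e = ⊥-elim (ℕₚ.even≢odd (2^ a ·odd b) d e)
2^·odd-injective (suc a) b (suc c) d e with 2^·odd-injective a b c d (ℕₚ.*-cancelˡ-≡ _ _ 2 e)
... | e₁ , e₂ = cong suc e₁ , e₂

2^·odd-positive : ∀ a b → 0 < 2^ a ·odd b
2^·odd-positive zero    b = s≤s z≤n
2^·odd-positive (suc a) b = ℕₚ.≤-trans (2^·odd-positive a b) (ℕₚ.m≤m+n _ _)

-- Every positive integer is 2^a (2b + 1) for exactly one pair a, b, and 0 remains free for the
-- empty list.
encode : List ℕ → ℕ
encode []       = 0
encode (n ∷ ns) = 2^ n ·odd encode ns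

encode-injective : ∀ {ms ns} → encode ms ≡ encode ns → ms ≡ ns
encode-injective {[]}     {[]}     _ = refl
encode-injective {[]}     {n ∷ ns} e = ⊥-elim (ℕₚ.<-irrefl e (2^·odd-positive n (encode ns)))
encode-injective {m ∷ ms} {[]}     e = ⊥-elim (ℕₚ.<-irrefl (sym e) (2^·odd-positive m (encode ms)))
encode-injective {m ∷ ms} {n ∷ ns} e with 2^·odd-injective m (encode ms) n (encode ns) e
... | e₁ , e₂ = cong₂ _∷_ e₁ (encode-injective e₂)

-- Colour refinement and the expressive power of networks

module Colouring {X : Set} (ι : X ↣ ℕ) where

  -- A complete isomorphism invariant of rooted trees with values in ℕ.
  code  : Tree X → ℕ
  codes : List (Tree X) → List ℕ
  code (node x Ts) = encode (Injection.to ι x ∷ sort (codes Ts))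
  codes []       = []
  codes (T ∷ Ts) = code T ∷ codes Ts

  -- `codes` spells out `map code` to keep `code` structurally recursive; this returns to `map`,
  -- where the lemmas on permutations apply.
  codes≡map : ∀ Ts → codes Ts ≡ map code Ts
  codes≡map []       = refl
  codes≡map (T ∷ Ts) = cong (code T ∷_) (codes≡map Ts)

  node-code-injective : ∀ {x y} {Ts Us} → code (node x Ts) ≡ code (node y Us) →
                        x ≡ y × map code Ts ↭ map code Us
  node-code-injective {x} {y} {Ts} {Us} e =
      Injection.injective ι (∷-injectiveˡ e′)
    , subst₂ _↭_ (codes≡map Ts) (codes≡map Us) (sort-reflects (∷-injectiveʳ e′))
    where
    e′ = encode-injective {Injection.to ι x ∷ sort (codes Ts)} {Injection.to ι y ∷ sort (codes Us)} e

  node-code-cong : ∀ {x y} {Ts Us} → x ≡ y → map code Ts ↭ map code Us →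
                   code (node x Ts) ≡ code (node y Us)
  node-code-cong {x} {Ts = Ts} {Us} refl p = cong (λ ns → encode (Injection.to ι x ∷ ns))
    (sort-cong (subst₂ _↭_ (sym (codes≡map Ts)) (sym (codes≡map Us)) p))

  code⇒≅  : ∀ T U → code T ≡ code U → T ≅ U
  codes⇒≅ : ∀ Ts i U → code (lookup Ts i) ≡ code U → lookup Ts i ≅ U
  code⇒≅ (node x Ts) (node y Us) e with node-code-injective {x} {y} {Ts} {Us} e
  ... | refl , p with map-↭⇒indices code code p
  ... | σ , eq = node-≅ σ (λ i → codes⇒≅ Ts i _ (eq i))
  codes⇒≅ (T ∷ Ts) zero    U e = code⇒≅ T U e
  codes⇒≅ (T ∷ Ts) (suc i) U e = codes⇒≅ Ts i U e

  ≅⇒code  : ∀ T U → T ≅ U → code T ≡ code U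
  ≅⇒codes : ∀ Ts i U → lookup Ts i ≅ U → code (lookup Ts i) ≡ code U
  ≅⇒code (node x Ts) (node y Us) e = node-code-cong {Ts = Ts} {Us} (root-feature e)
    (indices⇒map-↭ code code (childIndices e) (λ i → ≅⇒codes Ts i _ (subtree e i)))
  ≅⇒codes (T ∷ Ts) zero    U e = ≅⇒code T U e
  ≅⇒codes (T ∷ Ts) (suc i) U e = ≅⇒codes Ts i U e

  colour : ∀ {t} → ℕ → Graph X t → Fin t → ℕ
  colour k G v = code (cr k G v)

  module _ {t u} {G : Graph X t} {H : Graph X u} where

    colour-feature : ∀ k {v w} → colour k G v ≡ colour k H w → feature G v ≡ feature H w
    colour-feature zero    e = proj₁ (node-code-injective {Ts = []} {[]} e)
    colour-feature (suc k) {v} {w} e = proj₁ (node-code-injective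
      {Ts = map (cr k G) (neighbors G v)} {map (cr k H) (neighbors H w)} e)

    colour-neighbors : ∀ k {v w} → colour (suc k) G v ≡ colour (suc k) H w →
      map (colour k G) (neighbors G v) ↭ map (colour k H) (neighbors H w)
    colour-neighbors k {v} {w} e = subst₂ _↭_ (sym (map-∘ (neighbors G v))) (sym (map-∘ (neighbors H w)))
      (proj₂ (node-code-injective {Ts = map (cr k G) (neighbors G v)} {map (cr k H) (neighbors H w)} e))
      where open import Data.List.Properties using (map-∘)

    -- Equal colours of round k + 1 match the neighbours so that partners have equal colours of
    -- round k; whatever those colours determine then agrees along the matching.
    map-neighbors : ∀ {A : Set} k (f : Fin t → A) (g : Fin u → A) →
      (∀ v w → colour k G v ≡ colour k H w → f v ≡ g w) →
      ∀ v w → colour (suc k) G v ≡ colour (suc k) H w →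
      map f (neighbors G v) ↭ map g (neighbors H w)
    map-neighbors k f g h v w e with map-↭⇒indices (colour k G) (colour k H) (colour-neighbors k e)
    ... | σ , eq = indices⇒map-↭ f g σ (λ i → h _ _ (eq i))

    -- Refinement never merges classes: by induction matched neighbours also agree in the previous
    -- round, which is `map-neighbors` applied to the colourings themselves.
    colour-pred : ∀ k v w → colour (suc k) G v ≡ colour (suc k) H w → colour k G v ≡ colour k H w
    colour-pred zero    v w e = node-code-cong {Ts = []} {[]} (colour-feature 1 e) ↭-refl
    colour-pred (suc k) v w e = node-code-cong
      {Ts = map (cr k G) (neighbors G v)} {map (cr k H) (neighbors H w)} (colour-feature (suc (suc k)) e)
      (subst₂ _↭_ (map-∘ (neighbors G v)) (map-∘ (neighbors H w))
        (map-neighbors (suc k) (colour k G) (colour k H) (colour-pred k) v w e))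
      where open import Data.List.Properties using (map-∘)

    -- The upper bound on expressive power. A layer reads the state of the node, covered by
    -- `colour-pred`, and the multiset of its neighbours' states, covered by `map-neighbors`. The
    -- nodes may lie in different graphs, so the output depends on the tree alone.
    eval-colour : ∀ {k A} (f : MPNN X k A) v w → colour k G v ≡ colour k H w → eval f G v ≡ eval f H w
    eval-colour input                    v w e = colour-feature 0 e
    eval-colour {suc k} (layer f agg agg-↭ comb) v w e = cong₂ comb
      (eval-colour f v w (colour-pred k v w e))
      (agg-↭ (map-neighbors k (eval f G) (eval f H) (eval-colour f) v w e))

  -- The state carries the feature besides the colour, since each new code starts with the feature
  -- again. The output type is hidden because it is `X` before the first layer and `X × ℕ`
  -- afterwards.
  record ColourNetwork (k : ℕ) : Set₁ where
    field
      {Output}  : Set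
      network   : MPNN X k Output
      feature′  : Output → X
      colour′   : Output → ℕ
      feature-≡ : ∀ {t} (G : Graph X t) v → feature′ (eval network G v) ≡ feature G v
      colour-≡  : ∀ {t} (G : Graph X t) v → colour′ (eval network G v) ≡ colour k G v

  colourNetwork : ∀ k → ColourNetwork k
  colourNetwork zero = record
    { network   = input
    ; feature′  = λ x → x
    ; colour′   = λ x → encode (Injection.to ι x ∷ sort [])
    ; feature-≡ = λ _ _ → refl
    ; colour-≡  = λ _ _ → refl
    }
  colourNetwork (suc k) = record
    { network   = layer network (sort ∘ map colour′) (sort-cong ∘ map⁺ colour′)
                    (λ a ns → feature′ a , encode (Injection.to ι (feature′ a) ∷ ns))
    ; feature′  = proj₁
    ; colour′   = proj₂
    ; feature-≡ = feature-≡
    ; colour-≡  = λ G v → cong₂ (λ x ns → encode (Injection.to ι x ∷ sort ns)) (feature-≡ G v)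
        (trans (sym (map-∘ (neighbors G v)))
          (trans (map-cong (colour-≡ G) (neighbors G v))
            (trans (map-∘ (neighbors G v)) (sym (codes≡map _)))))
    }
    where
    open ColourNetwork (colourNetwork k)

  -- Fails for k = 0: an input network has no combination function to postcompose with.
  colourFunction : ∀ {B : Set} k (h : ℕ → B) →
    Σ[ f ∈ MPNN X (suc k) B ] (∀ {t} (G : Graph X t) v → eval f G v ≡ h (colour (suc k) G v))
  colourFunction k h = postcompose network (h ∘ colour′) , λ G v →
    trans (eval-postcompose network (h ∘ colour′) G v) (cong h (colour-≡ G v))
    where
    open ColourNetwork (colourNetwork (suc k))
    postcompose : ∀ {k A B} → MPNN X (suc k) A → (A → B) → MPNN X (suc k) B
    postcompose (layer f agg agg-↭ comb) g = layer f agg agg-↭ (λ a m → g (comb a m))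
    eval-postcompose : ∀ {k A B} (f : MPNN X (suc k) A) (g : A → B) {t} (G : Graph X t) v →
                       eval (postcompose f g) G v ≡ g (eval f G v)
    eval-postcompose (layer _ _ _ _) g G v = refl

-- Rational numbers

/-+ : ∀ m n d → + m / suc d ℚ.+ + n / suc d ≡ + (m ℕ.+ n) / suc d
/-+ m n d = ℚₚ.toℚᵘ-injective (begin
  ℚ.toℚᵘ (+ m / suc d ℚ.+ + n / suc d)               ≈⟨ ℚₚ.toℚᵘ-homo-+ (+ m / suc d) (+ n / suc d) ⟩
  ℚ.toℚᵘ (+ m / suc d) ℚᵘ.+ ℚ.toℚᵘ (+ n / suc d)
    ≈⟨ ℚᵘₚ.+-cong (ℚₚ.toℚᵘ-fromℚᵘ (mkℚᵘ (+ m) d)) (ℚₚ.toℚᵘ-fromℚᵘ (mkℚᵘ (+ n) d)) ⟩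
  mkℚᵘ (+ m) d ℚᵘ.+ mkℚᵘ (+ n) d
    ≈⟨ ℚᵘ.*≡* (trans (cong (ℤ._* + suc d) (sym (ℤₚ.*-distribʳ-+ (+ suc d) (+ m) (+ n))))
                 (ℤₚ.*-assoc (+ m ℤ.+ + n) (+ suc d) (+ suc d))) ⟩
  mkℚᵘ (+ (m ℕ.+ n)) d                        ≈⟨ ℚᵘₚ.≃-sym (ℚₚ.toℚᵘ-fromℚᵘ (mkℚᵘ (+ (m ℕ.+ n)) d)) ⟩
  ℚ.toℚᵘ (+ (m ℕ.+ n) / suc d)                ∎)
  where open import Relation.Binary.Reasoning.Setoid ℚᵘₚ.≃-setoid

fromℚᵘ-mono-≤ : ∀ {p q} → p ℚᵘ.≤ q → ℚ.fromℚᵘ p ℚ.≤ ℚ.fromℚᵘ q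
fromℚᵘ-mono-≤ {p} {q} p≤q = ℚₚ.toℚᵘ-cancel-≤
  (ℚᵘₚ.≤-respˡ-≃ (ℚᵘₚ.≃-sym (ℚₚ.toℚᵘ-fromℚᵘ p)) (ℚᵘₚ.≤-respʳ-≃ (ℚᵘₚ.≃-sym (ℚₚ.toℚᵘ-fromℚᵘ q)) p≤q))

/-mono : ∀ {m n} d → m ≤ n → + m / suc d ℚ.≤ + n / suc d
/-mono {m} {n} d m≤n = fromℚᵘ-mono-≤ {mkℚᵘ (+ m) d} {mkℚᵘ (+ n) d}
  (ℚᵘ.*≤* (ℤₚ.*-monoʳ-≤-nonNeg (+ suc d) (ℤ.+≤+ m≤n)))

/-antimono : ∀ m {d e} → d ≤ e → + m / suc e ℚ.≤ + m / suc d
/-antimono m {d} {e} d≤e = fromℚᵘ-mono-≤ {mkℚᵘ (+ m) e} {mkℚᵘ (+ m) d}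
  (ℚᵘ.*≤* (ℤₚ.*-monoˡ-≤-nonNeg (+ m) (ℤ.+≤+ (s≤s d≤e))))

0/ : ∀ d → + 0 / suc d ≡ 0ℚ
0/ d = ℚₚ.toℚᵘ-injective (ℚᵘₚ.≃-trans (ℚₚ.toℚᵘ-fromℚᵘ (mkℚᵘ (+ 0) d)) (ℚᵘ.*≡* refl))

n/n : ∀ d → + suc d / suc d ≡ 1ℚ
n/n d = ℚₚ.toℚᵘ-injective (ℚᵘₚ.≃-trans (ℚₚ.toℚᵘ-fromℚᵘ (mkℚᵘ (+ suc d) d)) (ℚᵘ.*≡* (ℤₚ.*-comm (+ suc d) (+ 1))))

0<1/ : ∀ d → 0ℚ ℚ.< + 1 / suc d
0<1/ d = ℚₚ.toℚᵘ-cancel-< (ℚᵘₚ.<-respʳ-≃ (ℚᵘₚ.≃-sym (ℚₚ.toℚᵘ-fromℚᵘ (mkℚᵘ (+ 1) d))) (ℚᵘ.*<* (ℤ.+<+ (s≤s z≤n))))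

archimedean : ∀ {ε} → 0ℚ ℚ.< ε → ∃[ d ] + 1 / suc d ℚ.≤ ε
archimedean {mkℚ (+ 0) d _}     (ℚ.*<* (ℤ.+<+ ()))
archimedean {mkℚ -[1+ n ] d _}  (ℚ.*<* ())
archimedean {ε@(mkℚ +[1+ n ] d _)} _ = d , ℚₚ.toℚᵘ-cancel-≤
  (ℚᵘₚ.≤-respˡ-≃ (ℚᵘₚ.≃-sym (ℚₚ.toℚᵘ-fromℚᵘ (mkℚᵘ (+ 1) d)))
    (ℚᵘ.*≤* (ℤₚ.*-monoʳ-≤-nonNeg (+ suc d) {+ 1} {+[1+ n ]} (ℤ.+≤+ (s≤s z≤n)))))

<⇒≱ : ∀ {p q} → p ℚ.< q → ¬ q ℚ.≤ p
<⇒≱ p<q q≤p = ℚₚ.<-irrefl refl (ℚₚ.<-≤-trans p<q q≤p)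

-- Linear arithmetic by certificate: `p ≤ q` is a sum of hypotheses, and the ring solver checks that
-- the goal has the same slack. `≼-linear` does the same for reals, on the terms of the sequences.
ℚ-linear : ∀ {p q r s} → p ℚ.≤ q → q ℚ.- p ≡ s ℚ.- r → r ℚ.≤ s
ℚ-linear {p} {q} {r} {s} p≤q e = subst₂ ℚ._≤_ (cancel p r) (trans (cong (ℚ._+ r) e) (restore s r))
  (ℚₚ.+-monoˡ-≤ r (ℚₚ.+-monoˡ-≤ (ℚ.- p) p≤q))
  where
  cancel : ∀ p r → p ℚ.- p ℚ.+ r ≡ r
  cancel = solve 2 (λ p r → p :- p :+ r := r) refl
  restore : ∀ s r → s ℚ.- r ℚ.+ r ≡ s
  restore = solve 2 (λ s r → s :- r :+ r := s) refl

0≤1 : 0ℚ ℚ.≤ 1ℚ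
0≤1 = ℚₚ.<⇒≤ (ℚₚ.positive⁻¹ 1ℚ)

half-pos : ∀ {ε} → 0ℚ ℚ.< ε → 0ℚ ℚ.< ½ ℚ.* ε
half-pos {ε} 0<ε = subst (ℚ._< ½ ℚ.* ε) (ℚₚ.*-zeroʳ ½) (ℚₚ.*-monoʳ-<-pos ½ 0<ε)

x≤x+ε : ∀ {ε} x → 0ℚ ℚ.≤ ε → x ℚ.≤ x ℚ.+ ε
x≤x+ε {ε} x 0≤ε = ℚ-linear 0≤ε (solve 2 (λ x ε → ε :- con 0ℚ := (x :+ ε) :- x) refl x ε)

x≤∣x∣ : ∀ x → x ℚ.≤ ℚ.∣ x ∣
x≤∣x∣ (mkℚ (+ n) d _)     = ℚₚ.≤-refl
x≤∣x∣ x@(mkℚ -[1+ n ] d _) = ℚₚ.≤-trans {j = 0ℚ} (ℚ.*≤* (ℤ.-≤+)) (ℚₚ.0≤∣p∣ x)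

∣-∣≤⁻ : ∀ {p q ε} → ℚ.∣ p ℚ.- q ∣ ℚ.≤ ε → p ℚ.≤ q ℚ.+ ε × q ℚ.≤ p ℚ.+ ε
∣-∣≤⁻ {p} {q} {ε} h =
    ℚ-linear (ℚₚ.≤-trans (x≤∣x∣ (p ℚ.- q)) h) (solve 3 (λ p q ε → ε :- (p :- q) := q :+ ε :- p) refl p q ε)
  , ℚ-linear (ℚₚ.≤-trans (x≤∣x∣ (ℚ.- (p ℚ.- q))) (subst (ℚ._≤ ε) (sym (ℚₚ.∣-p∣≡∣p∣ (p ℚ.- q))) h))
      (solve 3 (λ p q ε → ε :- (:- (p :- q)) := p :+ ε :- q) refl p q ε)

∣-∣≤⁺ : ∀ {p q ε} → p ℚ.≤ q ℚ.+ ε → q ℚ.≤ p ℚ.+ ε → ℚ.∣ p ℚ.- q ∣ ℚ.≤ ε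
∣-∣≤⁺ {p} {q} {ε} h h′ with ℚₚ.∣p∣≡p∨∣p∣≡-p (p ℚ.- q)
... | inj₁ e = subst (ℚ._≤ ε) (sym e) (ℚ-linear h (solve 3 (λ p q ε → q :+ ε :- p := ε :- (p :- q)) refl p q ε))
... | inj₂ e = subst (ℚ._≤ ε) (sym e) (ℚ-linear h′ (solve 3 (λ p q ε → p :+ ε :- q := ε :- (:- (p :- q))) refl p q ε))

-- Real numbers

infix 4 _≼_

-- A record around _≤ℝ_, so that the two reals can be inferred from the type.
record _≼_ (x y : ℝ) : Set where
  constructor ⟨_⟩
  field ≼⇒≤ : x ≤ℝ y
open _≼_

≼-pointwise : ∀ {x y} → (∀ n → seq x n ℚ.≤ seq y n) → x ≼ y
≼-pointwise {x} {y} h = ⟨ (λ ε 0<ε → 0 , λ n _ → ℚₚ.≤-trans (h n) (x≤x+ε (seq y n) (ℚₚ.<⇒≤ 0<ε))) ⟩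

≼-reflexive : ∀ {x y} → (∀ n → seq x n ≡ seq y n) → x ≼ y
≼-reflexive h = ≼-pointwise (λ n → ℚₚ.≤-reflexive (h n))

infix 4 _≐_

record _≐_ (x y : ℝ) : Set where
  constructor pointwise
  field at : ∀ n → seq x n ≡ seq y n
open _≐_

≐-sym : ∀ {x y} → x ≐ y → y ≐ x
≐-sym e = pointwise (λ n → sym (at e n))

≐⇒≼ : ∀ {x y} → x ≐ y → x ≼ y
≐⇒≼ e = ≼-reflexive (at e)

≼-refl : ∀ {x} → x ≼ x
≼-refl = ≼-reflexive (λ _ → refl)

≼-linear : ∀ {x y u v} → x ≼ y → (∀ n → seq y n ℚ.- seq x n ≡ seq v n ℚ.- seq u n) → u ≼ v
≼-linear {x} {y} {u} {v} ⟨ h ⟩ e = ⟨ (λ ε 0<ε → let (N , p) = h ε 0<ε in N , λ n N≤n →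
  ℚ-linear (p n N≤n)
    (trans (shift (seq x n) (seq y n) ε) (trans (cong (ℚ._+ ε) (e n)) (sym (shift (seq u n) (seq v n) ε))))) ⟩
  where
  shift : ∀ x y ε → y ℚ.+ ε ℚ.- x ≡ (y ℚ.- x) ℚ.+ ε
  shift = solve 3 (λ x y ε → y :+ ε :- x := (y :- x) :+ ε) refl

+-mono-≼ : ∀ {x y u v} → x ≼ y → u ≼ v → x +ℝ u ≼ y +ℝ v
+-mono-≼ {x} {y} {u} {v} ⟨ h ⟩ ⟨ k ⟩ = ⟨ (λ ε 0<ε →
  let (M , p) = h (½ ℚ.* ε) (half-pos 0<ε)
      (N , q) = k (½ ℚ.* ε) (half-pos 0<ε)
  in M ⊔ N , λ n le → ℚ-linear (ℚₚ.+-mono-≤ (p n (ℕₚ.m⊔n≤o⇒m≤o M N le)) (q n (ℕₚ.m⊔n≤o⇒n≤o M N le)))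
       (regroup (seq x n) (seq y n) (seq u n) (seq v n) ε)) ⟩
  where
  regroup : ∀ x y u v ε → (y ℚ.+ ½ ℚ.* ε ℚ.+ (v ℚ.+ ½ ℚ.* ε)) ℚ.- (x ℚ.+ u) ≡ (y ℚ.+ v ℚ.+ ε) ℚ.- (x ℚ.+ u)
  regroup = solve 5 (λ x y u v ε → (y :+ con ½ :* ε :+ (v :+ con ½ :* ε)) :- (x :+ u) := (y :+ v :+ ε) :- (x :+ u)) refl

≼-trans : ∀ {x y z} → x ≼ y → y ≼ z → x ≼ z
≼-trans {x} {y} {z} h k = ≼-linear (+-mono-≼ h k) (λ n →
  solve 3 (λ x y z → y :+ z :- (x :+ y) := z :- x) refl (seq x n) (seq y n) (seq z n))

+-monoˡ-≼ : ∀ z {x y} → x ≼ y → x +ℝ z ≼ y +ℝ z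
+-monoˡ-≼ z h = +-mono-≼ h (≼-refl {z})

+-monoʳ-≼ : ∀ z {x y} → x ≼ y → z +ℝ x ≼ z +ℝ y
+-monoʳ-≼ z h = +-mono-≼ (≼-refl {z}) h

≼-approx : ∀ {x y} → (∀ ε → 0ℚ ℚ.< ε → x ≼ y +ℝ fromℚ ε) → x ≼ y
≼-approx {x} {y} h = ⟨ (λ ε 0<ε →
  let (N , p) = ≼⇒≤ (h (½ ℚ.* ε) (half-pos 0<ε)) (½ ℚ.* ε) (half-pos 0<ε)
  in N , λ n le → ℚ-linear (p n le) (regroup (seq x n) (seq y n) ε)) ⟩
  where
  regroup : ∀ x y ε → (y ℚ.+ ½ ℚ.* ε ℚ.+ ½ ℚ.* ε) ℚ.- x ≡ (y ℚ.+ ε) ℚ.- x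
  regroup = solve 3 (λ x y ε → (y :+ con ½ :* ε :+ con ½ :* ε) :- x := (y :+ ε) :- x) refl

fromℚ-mono : ∀ {p q} → p ℚ.≤ q → fromℚ p ≼ fromℚ q
fromℚ-mono h = ≼-pointwise (λ _ → h)

fromℚ-cancel : ∀ {p q} → fromℚ p ≼ fromℚ q → p ℚ.≤ q
fromℚ-cancel {p} {q} ⟨ h ⟩ = ℚₚ.≮⇒≥ λ q<p →
  let ε = ½ ℚ.* (p ℚ.- q)
      0<ε = half-pos (subst (ℚ._< p ℚ.- q) (ℚₚ.+-inverseʳ q) (ℚₚ.+-monoˡ-< (ℚ.- q) q<p))
      (N , k) = h ε 0<ε
  in <⇒≱ 0<ε (ℚ-linear (k N ℕₚ.≤-refl) (regroup p q))
  where
  regroup : ∀ p q → (q ℚ.+ ½ ℚ.* (p ℚ.- q)) ℚ.- p ≡ 0ℚ ℚ.- ½ ℚ.* (p ℚ.- q)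
  regroup = solve 2 (λ p q → (q :+ con ½ :* (p :- q)) :- p := con 0ℚ :- con ½ :* (p :- q)) refl

1/-scale : ∀ {r ε} → 0ℚ ℚ.≤ r → 0ℚ ℚ.< ε → ∃[ δ ] 0ℚ ℚ.< δ × r ℚ.* δ ℚ.≤ ε
1/-scale {r} {ε} 0≤r 0<ε = δ , 0<δ , (begin
  r ℚ.* δ              ≤⟨ ℚₚ.*-monoʳ-≤-nonNeg δ {{ℚ.nonNegative (ℚₚ.<⇒≤ 0<δ)}} (x≤x+ε r 0≤1) ⟩
  s ℚ.* δ              ≡⟨ ℚₚ.*-assoc s s⁻¹ ε ⟨
  s ℚ.* s⁻¹ ℚ.* ε      ≡⟨ cong (ℚ._* ε) (ℚₚ.*-inverseʳ s {{ℚₚ.pos⇒nonZero s {{s>0}}}}) ⟩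
  1ℚ ℚ.* ε             ≡⟨ ℚₚ.*-identityˡ ε ⟩
  ε                    ∎)
  where
  open ℚₚ.≤-Reasoning
  -- Adding 1 keeps the divisor positive when `r` is 0.
  s = r ℚ.+ 1ℚ
  s>0 : ℚ.Positive s
  s>0 = ℚ.positive (ℚₚ.+-mono-≤-< 0≤r (ℚₚ.positive⁻¹ 1ℚ))
  s⁻¹ = (ℚ.1/ s) {{ℚₚ.pos⇒nonZero s {{s>0}}}}
  δ = s⁻¹ ℚ.* ε
  0<δ : 0ℚ ℚ.< δ
  0<δ = subst (ℚ._< δ) (ℚₚ.*-zeroʳ s⁻¹) (ℚₚ.*-monoʳ-<-pos s⁻¹ {{ℚₚ.1/pos⇒pos s {{s>0}}}} 0<ε)

·-mono-≼ : ∀ {r x y} → 0ℚ ℚ.≤ r → x ≼ y → r ·ℝ x ≼ r ·ℝ y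
·-mono-≼ {r} {x} {y} 0≤r ⟨ h ⟩ = ⟨ (λ ε 0<ε →
  let (δ , 0<δ , rδ≤ε) = 1/-scale 0≤r 0<ε
      (N , p)          = h δ 0<δ
  in N , λ n le → ℚₚ.≤-trans (ℚₚ.*-monoˡ-≤-nonNeg r {{ℚ.nonNegative 0≤r}} (p n le))
       (ℚₚ.≤-trans (ℚₚ.≤-reflexive (ℚₚ.*-distribˡ-+ r (seq y n) δ)) (ℚₚ.+-monoʳ-≤ (r ℚ.* seq y n) rδ≤ε))) ⟩

·-monoˡ-≼ : ∀ {p q x} → p ℚ.≤ q → 0ℝ ≼ x → p ·ℝ x ≼ q ·ℝ x
·-monoˡ-≼ {p} {q} {x} p≤q 0≤x = ≼-linear
  (·-mono-≼ {q ℚ.- p} {0ℝ} {x} (ℚ-linear p≤q (solve 2 (λ p q → q :- p := q :- p :- con 0ℚ) refl p q)) 0≤x)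
  (λ n → solve 3 (λ p q x → (q :- p) :* x :- (q :- p) :* con 0ℚ := q :* x :- p :* x) refl p q (seq x n))

≼+ : ∀ {x ε} → 0ℚ ℚ.≤ ε → x ≼ x +ℝ fromℚ ε
≼+ {x} 0≤ε = ≼-pointwise (λ n → x≤x+ε (seq x n) 0≤ε)

-- A bound on the distance, split into two inequalities without absolute value so that each can be
-- added to others by `≼-linear`.
record Near (ε : ℚ) (x y : ℝ) : Set where
  constructor near
  field
    ≼ˡ : x ≼ y +ℝ fromℚ ε
    ≼ʳ : y ≼ x +ℝ fromℚ ε
open Near

0<⇒rational : ∀ {ε} → 0ℝ <ℝ ε → ∃[ δ ] 0ℚ ℚ.< δ × fromℚ δ ≼ ε
0<⇒rational {ε} (δ , 0<δ , N , h) = δ , 0<δ , ⟨ (λ η 0<η → N , λ n le →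
  ℚₚ.≤-trans (ℚ-linear (h n le) (solve 2 (λ δ e → e :- (con 0ℚ :+ δ) := e :- δ) refl δ (seq ε n)))
    (x≤x+ε (seq ε n) (ℚₚ.<⇒≤ 0<η))) ⟩

<-≼-trans : ∀ {x y z} → x <ℝ y → y ≼ z → x <ℝ z
<-≼-trans {x} {y} {z} (δ , 0<δ , N , h) ⟨ k ⟩ =
  let (M , p) = k (½ ℚ.* δ) (half-pos 0<δ)
  in ½ ℚ.* δ , half-pos 0<δ , N ⊔ M , λ n le →
       ℚ-linear (ℚₚ.+-mono-≤ (h n (ℕₚ.m⊔n≤o⇒m≤o N M le)) (p n (ℕₚ.m⊔n≤o⇒n≤o N M le)))
         (regroup (seq x n) (seq y n) (seq z n) δ)
  where
  regroup : ∀ x y z δ → (y ℚ.+ (z ℚ.+ ½ ℚ.* δ)) ℚ.- ((x ℚ.+ δ) ℚ.+ y) ≡ z ℚ.- (x ℚ.+ ½ ℚ.* δ)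
  regroup = solve 4 (λ x y z δ → (y :+ (z :+ con ½ :* δ)) :- ((x :+ δ) :+ y) := z :- (x :+ con ½ :* δ)) refl

<⇒≼ : ∀ {x y} → x <ℝ y → x ≼ y
<⇒≼ {x} {y} (δ , 0<δ , N , h) = ⟨ (λ ε 0<ε → N , λ n le →
  ℚₚ.≤-trans (x≤x+ε (seq x n) (ℚₚ.<⇒≤ 0<δ)) (ℚₚ.≤-trans (h n le) (x≤x+ε (seq y n) (ℚₚ.<⇒≤ 0<ε)))) ⟩

<⇒⋠ : ∀ {x y} → x <ℝ y → ¬ y ≼ x
<⇒⋠ {x} {y} x<y y≤x =
  let (δ , 0<δ , N , h) = <-≼-trans {x} {y} {x} x<y y≤x
  in <⇒≱ 0<δ (ℚ-linear (h N ℕₚ.≤-refl)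
       (solve 2 (λ x δ → x :- (x :+ δ) := con 0ℚ :- δ) refl (seq x N) δ))

0<fromℚ : ∀ {ε} → 0ℚ ℚ.< ε → 0ℝ <ℝ fromℚ ε
0<fromℚ {ε} 0<ε = ε , 0<ε , 0 , λ _ _ → ℚₚ.≤-reflexive (ℚₚ.+-identityˡ ε)

∣-∣≼⇒near : ∀ {ε x y} → ∣ x -ℝ y ∣ℝ ≼ fromℚ ε → Near ε x y
∣-∣≼⇒near {ε} {x} {y} ⟨ h ⟩ = near
  ⟨ (λ η 0<η → let (N , k) = h η 0<η in N , λ n le →
      ℚₚ.≤-trans (proj₁ (∣-∣≤⁻ (k n le))) (ℚₚ.≤-reflexive (sym (ℚₚ.+-assoc (seq y n) ε η)))) ⟩
  ⟨ (λ η 0<η → let (N , k) = h η 0<η in N , λ n le →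
      ℚₚ.≤-trans (proj₂ (∣-∣≤⁻ {p = seq x n} (k n le))) (ℚₚ.≤-reflexive (sym (ℚₚ.+-assoc (seq x n) ε η)))) ⟩

∣-∣<⇒near : ∀ {ε x y} → ∣ x -ℝ y ∣ℝ <ℝ fromℚ ε → Near ε x y
∣-∣<⇒near {ε} {x} {y} h = ∣-∣≼⇒near (<⇒≼ {∣ x -ℝ y ∣ℝ} {fromℚ ε} h)

near⇒∣-∣≼ : ∀ {ε x y} → Near ε x y → ∣ x -ℝ y ∣ℝ ≼ fromℚ ε
near⇒∣-∣≼ {ε} {x} {y} (near ⟨ h ⟩ ⟨ k ⟩) = ⟨ (λ η 0<η →
  let (M , p) = h η 0<η
      (N , q) = k η 0<η
  in M ⊔ N , λ n le → ∣-∣≤⁺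
       (ℚₚ.≤-trans (p n (ℕₚ.m⊔n≤o⇒m≤o M N le)) (ℚₚ.≤-reflexive (ℚₚ.+-assoc (seq y n) ε η)))
       (ℚₚ.≤-trans (q n (ℕₚ.m⊔n≤o⇒n≤o M N le)) (ℚₚ.≤-reflexive (ℚₚ.+-assoc (seq x n) ε η)))) ⟩

fromℚ-< : ∀ {p q} → p ℚ.< q → fromℚ p <ℝ fromℚ q
fromℚ-< {p} {q} p<q = q ℚ.- p
  , subst (ℚ._< q ℚ.- p) (ℚₚ.+-inverseʳ p) (ℚₚ.+-monoˡ-< (ℚ.- p) p<q) , 0 , λ _ _ →
  ℚₚ.≤-reflexive (solve 2 (λ p q → p :+ (q :- p) := q) refl p q)

≼-<-trans : ∀ {x y z} → x ≼ y → y <ℝ z → x <ℝ z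
≼-<-trans {x} {y} {z} ⟨ k ⟩ (δ , 0<δ , N , h) =
  let (M , p) = k (½ ℚ.* δ) (half-pos 0<δ)
  in ½ ℚ.* δ , half-pos 0<δ , N ⊔ M , λ n le →
       ℚ-linear (ℚₚ.+-mono-≤ (h n (ℕₚ.m⊔n≤o⇒m≤o N M le)) (p n (ℕₚ.m⊔n≤o⇒n≤o N M le)))
         (regroup (seq x n) (seq y n) (seq z n) δ)
  where
  regroup : ∀ x y z δ → (z ℚ.+ (y ℚ.+ ½ ℚ.* δ)) ℚ.- ((y ℚ.+ δ) ℚ.+ x) ≡ z ℚ.- (x ℚ.+ ½ ℚ.* δ)
  regroup = solve 4 (λ x y z δ → (z :+ (y :+ con ½ :* δ)) :- ((y :+ δ) :+ x) := z :- (x :+ con ½ :* δ)) refl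

half< : ∀ {ε} → 0ℚ ℚ.< ε → ½ ℚ.* ε ℚ.< ε
half< {ε} 0<ε = subst₂ ℚ._<_ (ℚₚ.+-identityʳ _) (solve 1 (λ ε → con ½ :* ε :+ con ½ :* ε := ε) refl ε)
  (ℚₚ.+-monoʳ-< (½ ℚ.* ε) (half-pos 0<ε))

near⇒∣-∣< : ∀ {ε} → 0ℝ <ℝ ε → ∃[ δ ] 0ℚ ℚ.< δ × (∀ {x y} → Near δ x y → ∣ x -ℝ y ∣ℝ <ℝ ε)
near⇒∣-∣< {ε} 0<ε =
  let (δ , 0<δ , δ≤ε) = 0<⇒rational {ε} 0<ε
  -- `Near` is a non-strict bound; halving the rational `δ` below `ε` makes it strict.
  in ½ ℚ.* δ , half-pos 0<δ , λ {x} {y} h →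
       <-≼-trans {∣ x -ℝ y ∣ℝ} {fromℚ δ}
         (≼-<-trans {∣ x -ℝ y ∣ℝ} {fromℚ (½ ℚ.* δ)} {fromℚ δ} (near⇒∣-∣≼ h) (fromℚ-< (half< 0<δ))) δ≤ε

rational-near : ∀ x {ε} → 0ℚ ℚ.< ε → ∃[ q ] Near ε x (fromℚ q)
rational-near x {ε} 0<ε =
  let (N , h) = cauchy x ε 0<ε
  in seq x N , near
       ⟨ (λ η 0<η → N , λ n le → ℚₚ.≤-trans (proj₁ (∣-∣≤⁻ (h n N le ℕₚ.≤-refl))) (x≤x+ε _ (ℚₚ.<⇒≤ 0<η))) ⟩
       ⟨ (λ η 0<η → N , λ n le → ℚₚ.≤-trans (proj₂ (∣-∣≤⁻ {p = seq x n} (h n N le ℕₚ.≤-refl))) (x≤x+ε _ (ℚₚ.<⇒≤ 0<η))) ⟩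

Near-+ : ∀ {ε x y u v} → Near (½ ℚ.* ε) x y → Near (½ ℚ.* ε) u v → Near ε (x +ℝ u) (y +ℝ v)
Near-+ {ε} {x} {y} {u} {v} (near h h′) (near k k′) = near
  (≼-linear (+-mono-≼ h k) (λ n → regroup (seq x n) (seq y n) (seq u n) (seq v n) ε))
  (≼-linear (+-mono-≼ h′ k′) (λ n → regroup (seq y n) (seq x n) (seq v n) (seq u n) ε))
  where
  regroup : ∀ x y u v ε → ((y ℚ.+ ½ ℚ.* ε) ℚ.+ (v ℚ.+ ½ ℚ.* ε)) ℚ.- (x ℚ.+ u) ≡ (y ℚ.+ v ℚ.+ ε) ℚ.- (x ℚ.+ u)
  regroup = solve 5 (λ x y u v ε → ((y :+ con ½ :* ε) :+ (v :+ con ½ :* ε)) :- (x :+ u) := (y :+ v :+ ε) :- (x :+ u)) refl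

-- Limits

Limit : (ℕ → ℝ) → ℝ → Set
Limit a L = ∀ ε → 0ℚ ℚ.< ε → ∃[ N ] ∀ t → N ≤ t → Near ε (a t) L

⟶⇒Limit : ∀ {a L} → a ⟶ L → Limit a L
⟶⇒Limit h ε 0<ε = let (N , k) = h (fromℚ ε) (0<fromℚ 0<ε) in N , λ t le → ∣-∣<⇒near (k t le)

Limit⇒⟶ : ∀ {a L} → Limit a L → a ⟶ L
Limit⇒⟶ h ε 0<ε = let (δ , 0<δ , p) = near⇒∣-∣< {ε} 0<ε
                      (N , k) = h δ 0<δ
                  in N , λ t le → p (k t le)

limit-mono : ∀ {a b L M} → Limit a L → Limit b M → ∃[ N ] (∀ t → N ≤ t → a t ≼ b t) → L ≼ M
limit-mono {a} {b} {L} {M} p q (N , h) = ≼-approx λ ε 0<ε →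
  let (N₁ , p′) = p (½ ℚ.* ε) (half-pos 0<ε)
      (N₂ , q′) = q (½ ℚ.* ε) (half-pos 0<ε)
      t = N ⊔ (N₁ ⊔ N₂)
      ≤₁ = ℕₚ.≤-trans (ℕₚ.m≤m⊔n N₁ N₂) (ℕₚ.m≤n⊔m N (N₁ ⊔ N₂))
      ≤₂ = ℕₚ.≤-trans (ℕₚ.m≤n⊔m N₁ N₂) (ℕₚ.m≤n⊔m N (N₁ ⊔ N₂))
  in ≼-linear (+-mono-≼ (≼ʳ (p′ t ≤₁)) (+-mono-≼ (h t (ℕₚ.m≤m⊔n N (N₁ ⊔ N₂))) (≼ˡ (q′ t ≤₂))))
       (λ n → solve 5 (λ l m a b ε → ((a :+ con ½ :* ε) :+ (b :+ (m :+ con ½ :* ε))) :- (l :+ (a :+ b)) := (m :+ ε) :- l)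
                refl (seq L n) (seq M n) (seq (a t) n) (seq (b t) n) ε)

limit-const : ∀ {x} → Limit (λ _ → x) x
limit-const ε 0<ε = 0 , λ _ _ → near (≼+ (ℚₚ.<⇒≤ 0<ε)) (≼+ (ℚₚ.<⇒≤ 0<ε))

limit-+ : ∀ {a b L M} → Limit a L → Limit b M → Limit (λ t → a t +ℝ b t) (L +ℝ M)
limit-+ p q ε 0<ε =
  let (N₁ , p′) = p (½ ℚ.* ε) (half-pos 0<ε)
      (N₂ , q′) = q (½ ℚ.* ε) (half-pos 0<ε)
  in N₁ ⊔ N₂ , λ t le → Near-+ (p′ t (ℕₚ.m⊔n≤o⇒m≤o N₁ N₂ le)) (q′ t (ℕₚ.m⊔n≤o⇒n≤o N₁ N₂ le))

-- Finite sums

∑ : ∀ {A : Set} → (A → ℝ) → List A → ℝ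
∑ f L = sumℝ (map f L)

module _ {A : Set} where

  ∑-mono : ∀ {f g : A → ℝ} → (∀ x → f x ≼ g x) → ∀ L → ∑ f L ≼ ∑ g L
  ∑-mono h []      = ≼-refl
  ∑-mono h (x ∷ L) = +-mono-≼ (h x) (∑-mono h L)

  ∑-nonneg : ∀ {f : A → ℝ} → (∀ x → 0ℝ ≼ f x) → ∀ L → 0ℝ ≼ ∑ f L
  ∑-nonneg h []      = ≼-refl
  ∑-nonneg h (x ∷ L) = ≼-trans (≼-reflexive (λ _ → refl)) (+-mono-≼ (h x) (∑-nonneg h L))

  ∑-+ : ∀ {f g h : A → ℝ} → (∀ x → h x ≐ f x +ℝ g x) → ∀ L → ∑ h L ≐ ∑ f L +ℝ ∑ g L
  ∑-+ e [] = pointwise (λ _ → refl)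
  ∑-+ {f} {g} {h} e (x ∷ L) = pointwise (λ n → trans (cong₂ ℚ._+_ (at (e x) n) (at (∑-+ {f} {g} {h} e L) n))
    (solve 4 (λ a b c d → (a :+ b) :+ (c :+ d) := (a :+ c) :+ (b :+ d)) refl
      (seq (f x) n) (seq (g x) n) (seq (∑ f L) n) (seq (∑ g L) n)))

  ∑-· : ∀ q (f : A → ℝ) L → ∑ (λ x → q ·ℝ f x) L ≐ q ·ℝ ∑ f L
  ∑-· q f []      = pointwise (λ _ → sym (ℚₚ.*-zeroʳ q))
  ∑-· q f (x ∷ L) = pointwise (λ n → trans (cong (q ℚ.* seq (f x) n ℚ.+_) (at (∑-· q f L) n))
    (sym (ℚₚ.*-distribˡ-+ q (seq (f x) n) (seq (∑ f L) n))))

  -- The tolerance is fixed before `f` and `g`: in the application `g` depends on the time and the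
  -- outcome, and the tolerance must not.
  ∑-perturb : ∀ (L : List A) {ε} → 0ℚ ℚ.< ε → ∃[ δ ] 0ℚ ℚ.< δ ×
    (∀ (f g : A → ℝ) → (∀ x → x ∈ L → f x ≼ g x +ℝ fromℚ δ) → ∑ f L ≼ ∑ g L +ℝ fromℚ ε)
  ∑-perturb []      {ε} 0<ε = ε , 0<ε , λ _ _ _ → ≼+ (ℚₚ.<⇒≤ 0<ε)
  ∑-perturb (x ∷ L) {ε} 0<ε =
    let (δ , 0<δ , h) = ∑-perturb L (half-pos 0<ε)
    in δ ℚ.⊓ (½ ℚ.* ε) , ⊓-pos 0<δ (half-pos 0<ε) , λ f g k → ≼-linear
         (+-mono-≼ (≼-trans (k x (here refl)) (+-monoʳ-≼ (g x) (fromℚ-mono (ℚₚ.p⊓q≤q δ (½ ℚ.* ε)))))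
           (h f g (λ y y∈L → ≼-trans (k y (there y∈L)) (+-monoʳ-≼ (g y) (fromℚ-mono (ℚₚ.p⊓q≤p δ (½ ℚ.* ε)))))))
         (λ n → solve 5 (λ a b c d ε → ((b :+ con ½ :* ε) :+ (d :+ con ½ :* ε)) :- (a :+ c)
                            := (b :+ d :+ ε) :- (a :+ c)) refl
           (seq (f x) n) (seq (g x) n) (seq (∑ f L) n) (seq (∑ g L) n) ε)
    where
    ⊓-pos : ∀ {p q} → 0ℚ ℚ.< p → 0ℚ ℚ.< q → 0ℚ ℚ.< p ℚ.⊓ q
    ⊓-pos {p} {q} 0<p 0<q with ℚₚ.≤-total p q
    ... | inj₁ p≤q = subst (0ℚ ℚ.<_) (sym (ℚₚ.p≤q⇒p⊓q≡p p≤q)) 0<p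
    ... | inj₂ q≤p = subst (0ℚ ℚ.<_) (sym (ℚₚ.p≥q⇒p⊓q≡q q≤p)) 0<q

  limit-∑ : ∀ {a : A → ℕ → ℝ} {L : A → ℝ} → (∀ x → Limit (a x) (L x)) →
            ∀ xs → Limit (λ t → ∑ (λ x → a x t) xs) (∑ L xs)
  limit-∑ h []       = limit-const
  limit-∑ h (x ∷ xs) = limit-+ (h x) (limit-∑ h xs)

-- Order and suprema of reals under excluded middle

module Completeness (em : ExcludedMiddle 0ℓ) where

  ⋠⇒gap : ∀ {x y} → ¬ x ≼ y → ∃[ ε ] 0ℚ ℚ.< ε × y +ℝ fromℚ ε ≼ x
  ⋠⇒gap {x} {y} x⋠y with em {∃[ ε ] 0ℚ ℚ.< ε × y +ℝ fromℚ ε ≼ x}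
  ... | yes gap = gap
  ... | no ¬gap = ⊥-elim (x⋠y ⟨ x≤y ⟩)
    where
    x≤y : x ≤ℝ y
    -- Beyond `N₁ ⊔ N₂` both sequences move by at most ε/4, so a single index with `y n + ε < x n`
    -- would give a gap of ε/2 at all later indices.
    x≤y ε 0<ε = N₁ ⊔ N₂ , λ n le → ℚₚ.≮⇒≥ λ y+ε<x →
        ¬gap (½ ℚ.* ε , half-pos 0<ε , ⟨ (λ η 0<η → N₁ ⊔ N₂ , λ m le′ → ℚₚ.≤-trans
          (ℚ-linear (ℚₚ.+-mono-≤ (ℚₚ.<⇒≤ y+ε<x) (ℚₚ.+-mono-≤
              (proj₁ (∣-∣≤⁻ {p = seq x n} (h₁ n m (ℕₚ.m⊔n≤o⇒m≤o N₁ N₂ le) (ℕₚ.m⊔n≤o⇒m≤o N₁ N₂ le′))))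
              (proj₁ (∣-∣≤⁻ {p = seq y m} (h₂ m n (ℕₚ.m⊔n≤o⇒n≤o N₁ N₂ le′) (ℕₚ.m⊔n≤o⇒n≤o N₁ N₂ le))))))
            (regroup (seq x n) (seq x m) (seq y n) (seq y m) ε))
          (x≤x+ε (seq x m) (ℚₚ.<⇒≤ 0<η))) ⟩)
      where
      δ = ½ ℚ.* (½ ℚ.* ε)
      0<δ = half-pos (half-pos 0<ε)
      N₁ = proj₁ (cauchy x δ 0<δ)
      h₁ = proj₂ (cauchy x δ 0<δ)
      N₂ = proj₁ (cauchy y δ 0<δ)
      h₂ = proj₂ (cauchy y δ 0<δ)
      regroup : ∀ xn xm yn ym ε →
        (xn ℚ.+ ((xm ℚ.+ ½ ℚ.* (½ ℚ.* ε)) ℚ.+ (yn ℚ.+ ½ ℚ.* (½ ℚ.* ε)))) ℚ.- ((yn ℚ.+ ε) ℚ.+ (xn ℚ.+ ym))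
        ≡ xm ℚ.- (ym ℚ.+ ½ ℚ.* ε)
      regroup = solve 5 (λ xn xm yn ym ε →
        (xn :+ ((xm :+ con ½ :* (con ½ :* ε)) :+ (yn :+ con ½ :* (con ½ :* ε)))) :- ((yn :+ ε) :+ (xn :+ ym))
        := xm :- (ym :+ con ½ :* ε)) refl

  ⋠⇒≽ : ∀ {x y} → ¬ x ≼ y → y ≼ x
  ⋠⇒≽ h with ⋠⇒gap h
  ... | ε , 0<ε , k = ≼-trans (≼+ (ℚₚ.<⇒≤ 0<ε)) k

  module Supremum (Q : ℚ → Set) (Q-down : ∀ {p q} → p ℚ.≤ q → Q q → Q p) (Q0 : Q 0ℚ) (Q≤1 : ∀ q → Q q → q ℚ.≤ 1ℚ) where

    gridPoint : ∀ d → ∃[ a ] Q a × ¬ Q (a ℚ.+ + 1 / suc d)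
    gridPoint d with em {∃[ a ] Q a × ¬ Q (a ℚ.+ + 1 / suc d)}
    ... | yes h = h
    -- Otherwise `Q` would be closed under adding 1/(d+1), hence contain 1 and then 1 + 1/(d+1).
    ... | no ¬h = ⊥-elim (<⇒≱ 1<1+1/ (Q≤1 _ (advance (subst Q (n/n d) (multiples (suc d))))))
      where
      advance : ∀ {a} → Q a → Q (a ℚ.+ + 1 / suc d)
      advance {a} Qa with em {Q (a ℚ.+ + 1 / suc d)}
      ... | yes h = h
      ... | no ¬Q = ⊥-elim (¬h (a , Qa , ¬Q))
      multiples : ∀ n → Q (+ n / suc d)
      multiples zero    = subst Q (sym (0/ d)) Q0
      multiples (suc n) = subst Q (trans (/-+ n 1 d) (cong (λ m → + m / suc d) (ℕₚ.+-comm n 1))) (advance (multiples n))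
      1<1+1/ : 1ℚ ℚ.< 1ℚ ℚ.+ + 1 / suc d
      1<1+1/ = subst (ℚ._< 1ℚ ℚ.+ + 1 / suc d) (ℚₚ.+-identityʳ 1ℚ) (ℚₚ.+-monoʳ-< 1ℚ (0<1/ d))

    a : ℕ → ℚ
    a d = proj₁ (gridPoint d)

    a-upper : ∀ d {q} → Q q → q ℚ.≤ a d ℚ.+ + 1 / suc d
    a-upper d {q} Qq with ℚₚ.≤-total q (a d ℚ.+ + 1 / suc d)
    ... | inj₁ le = le
    ... | inj₂ ge = ⊥-elim (proj₂ (proj₂ (gridPoint d)) (Q-down ge Qq))

    a-upper′ : ∀ {d n q ε} → + 1 / suc d ℚ.≤ ε → d ≤ n → Q q → q ℚ.≤ a n ℚ.+ ε
    a-upper′ {d} {n} h le Qq = ℚₚ.≤-trans (a-upper n Qq) (ℚₚ.+-monoʳ-≤ (a n) (ℚₚ.≤-trans (/-antimono 1 le) h))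

    Qa : ∀ d → Q (a d)
    Qa d = proj₁ (proj₂ (gridPoint d))

    -- The points `a d` are chosen independently of one another. They form a Cauchy sequence because
    -- `a n` + 1/(n+1) bounds all of `Q`, in particular every `a m`.
    sup : ℝ
    sup = mkℝ a λ ε 0<ε → let (d , h) = archimedean 0<ε in d , λ m n m≤ n≤ →
      ∣-∣≤⁺ (a-upper′ h n≤ (Qa m)) (a-upper′ h m≤ (Qa n))

    sup-upper : ∀ {q} → Q q → fromℚ q ≼ sup
    sup-upper Qq = ⟨ (λ ε 0<ε → let (d , h) = archimedean 0<ε in d , λ n le → a-upper′ h le Qq) ⟩

    sup-approx : ∀ ε → 0ℚ ℚ.< ε → ∃[ q ] Q q × sup ≼ fromℚ q +ℝ fromℚ ε
    sup-approx ε 0<ε = let (d , h) = archimedean 0<ε in a d , Qa d , ≼-pointwise (λ n → a-upper′ h ℕₚ.≤-refl (Qa n))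

  supremum : (Q : ℚ → Set) → (∀ {p q} → p ℚ.≤ q → Q q → Q p) → Q 0ℚ → (∀ q → Q q → q ℚ.≤ 1ℚ) →
    ∃[ s ] (∀ {q} → Q q → fromℚ q ≼ s) × (∀ ε → 0ℚ ℚ.< ε → ∃[ q ] Q q × s ≼ fromℚ q +ℝ fromℚ ε)
  supremum Q Q-down Q0 Q≤1 = sup , sup-upper , sup-approx
    where open Supremum Q Q-down Q0 Q≤1

  -- Unordered sums

  module Sums (S : Setoid 0ℓ 0ℓ) where
    open Setoid S using (Carrier; _≈_; isEquivalence) renaming (refl to ≈-refl; sym to ≈-sym; trans to ≈-trans)
    open Data.List.Relation.Unary.Unique.Setoid S using (Unique) public
    open Data.List.Relation.Binary.Subset.Setoid S using (_⊆_) public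
    open Data.List.Membership.Setoid S using () renaming (_∈_ to _∈ˢ_) public

    decSetoid : DecSetoid 0ℓ 0ℓ
    decSetoid = record { Carrier = Carrier
                       ; _≈_ = _≈_
                       ; isDecEquivalence = record { isEquivalence = isEquivalence ; _≟_ = λ x y → em } }

    union : ∀ L M → ∃[ N ] Unique N × L ⊆ N × M ⊆ N
    union L M = deduplicate _≟_ (L ++ M) , DecUnique.deduplicate-! decSetoid (L ++ M)
      , (λ x∈L → Membershipₚ.∈-deduplicate⁺ S _≟_ (λ e e′ → ≈-trans e′ (≈-sym e)) (Membershipₚ.∈-++⁺ˡ S x∈L))
      , (λ x∈M → Membershipₚ.∈-deduplicate⁺ S _≟_ (λ e e′ → ≈-trans e′ (≈-sym e)) (Membershipₚ.∈-++⁺ʳ S L x∈M))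
      where open DecSetoid decSetoid using (_≟_)

    infix 4 _sumsTo_

    record _sumsTo_ (f : Carrier → ℝ) (s : ℝ) : Set where
      constructor summable
      field partialSums : ∀ ε → 0ℚ ℚ.< ε → ∃[ L ] Unique L × (∀ L′ → Unique L′ → L ⊆ L′ → Near ε (∑ f L′) s)
    open _sumsTo_ public

    HasSum⇒sumsTo : ∀ {f s} → HasSum S f s → f sumsTo s
    HasSum⇒sumsTo h = summable λ ε 0<ε →
      let (L , L! , k) = h (fromℚ ε) (0<fromℚ 0<ε) in L , L! , λ L′ L′! L⊆L′ → ∣-∣<⇒near (k L′ L′! L⊆L′)

    sumsTo⇒HasSum : ∀ {f s} → f sumsTo s → HasSum S f s
    sumsTo⇒HasSum h ε 0<ε =
      let (δ , 0<δ , near⇒)  = near⇒∣-∣< {ε} 0<ε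
          (L , L! , k) = partialSums h δ 0<δ
      in L , L! , λ L′ L′! L⊆L′ → near⇒ (k L′ L′! L⊆L′)

    sumsTo-mono : ∀ {f g s t} → (∀ x → f x ≼ g x) → f sumsTo s → g sumsTo t → s ≼ t
    sumsTo-mono {f} {g} {s} {t} f≼g h k = ≼-approx λ ε 0<ε →
      let (L , _ , p)          = partialSums h (½ ℚ.* ε) (half-pos 0<ε)
          (M , _ , q)          = partialSums k (½ ℚ.* ε) (half-pos 0<ε)
          (N , N! , L⊆N , M⊆N) = union L M
      in ≼-linear (+-mono-≼ (≼ʳ (p N N! L⊆N)) (+-mono-≼ (∑-mono f≼g N) (≼ˡ (q N N! M⊆N))))
           (λ n → solve 5 (λ s t a b ε → ((a :+ con ½ :* ε) :+ (b :+ (t :+ con ½ :* ε))) :- (s :+ (a :+ b))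
                            := (t :+ ε) :- s)
             refl (seq s n) (seq t n) (seq (∑ f N) n) (seq (∑ g N) n) ε)

    sumsTo-+ : ∀ {f g h s t} → (∀ x → h x ≐ f x +ℝ g x) →
               f sumsTo s → g sumsTo t → h sumsTo s +ℝ t
    sumsTo-+ {f} {g} {h} {s} {t} e p q = summable λ ε 0<ε →
      let (L , _ , p′)         = partialSums p (½ ℚ.* ε) (half-pos 0<ε)
          (M , _ , q′)         = partialSums q (½ ℚ.* ε) (half-pos 0<ε)
          (N , N! , L⊆N , M⊆N) = union L M
      in N , N! , λ L′ L′! N⊆L′ →
           let (near a b) = Near-+ {ε} {∑ f L′} {s} {∑ g L′} {t}
                        (p′ L′ L′! (λ x → N⊆L′ (L⊆N x)))
                        (q′ L′ L′! (λ x → N⊆L′ (M⊆N x)))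
               ∑h≐ = ∑-+ {f = f} {g} {h} e L′
           in near (≼-trans (≐⇒≼ ∑h≐) a) (≼-trans b (+-monoˡ-≼ (fromℚ ε) (≐⇒≼ (≐-sym ∑h≐))))

    sumsTo-· : ∀ {f s q} → 0ℚ ℚ.≤ q → f sumsTo s → (λ x → q ·ℝ f x) sumsTo q ·ℝ s
    sumsTo-· {f} {s} {q} 0≤q h = summable λ ε 0<ε →
      let (δ , 0<δ , qδ≤ε) = 1/-scale 0≤q 0<ε
          (L , L! , k) = partialSums h δ 0<δ
          scale : ∀ x y → x ≼ y +ℝ fromℚ δ → q ·ℝ x ≼ q ·ℝ y +ℝ fromℚ ε
          scale x y h = ≼-trans (·-mono-≼ 0≤q h)
            (≼-trans (≐⇒≼ {y = q ·ℝ y +ℝ fromℚ (q ℚ.* δ)} (pointwise λ n → ℚₚ.*-distribˡ-+ q (seq y n) δ))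
            (+-monoʳ-≼ (q ·ℝ y) (fromℚ-mono qδ≤ε)))
      in L , L! , λ L′ L′! L⊆L′ →
           let ∑≐ = ∑-· q f L′
           in near (≼-trans (≐⇒≼ ∑≐) (scale (∑ f L′) s (≼ˡ (k L′ L′! L⊆L′))))
                (≼-trans (scale s (∑ f L′) (≼ʳ (k L′ L′! L⊆L′))) (+-monoˡ-≼ (fromℚ ε) (≐⇒≼ (≐-sym ∑≐))))

    module _ {f : Carrier → ℝ} (f-nonneg : ∀ x → 0ℝ ≼ f x) (f-cong : ∀ {x y} → x ≈ y → f x ≼ f y) where

      extract : ∀ {x L} → x ∈ˢ L → ∃[ M ] f x +ℝ ∑ f M ≼ ∑ f L × (∀ {y} → y ∈ˢ L → ¬ x ≈ y → y ∈ˢ M)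
      extract {L = z ∷ L} (here x≈z) = L , +-monoˡ-≼ (∑ f L) (f-cong x≈z) , λ
        { (here y≈z) x≉y → ⊥-elim (x≉y (≈-trans x≈z (≈-sym y≈z)))
        ; (there y∈L) _  → y∈L }
      extract {x} {L = z ∷ L} (there x∈L) =
        let (M , h , k) = extract x∈L
        in z ∷ M
         , ≼-linear (+-monoʳ-≼ (f z) h) (λ n →
             solve 4 (λ x z m l → z :+ l :- (z :+ (x :+ m)) := z :+ l :- (x :+ (z :+ m))) refl
               (seq (f x) n) (seq (f z) n) (seq (∑ f M) n) (seq (∑ f L) n))
         , λ { (here y≈z) _     → here y≈z
             ; (there y∈L) x≉y → there (k y∈L x≉y) }

      -- The inclusion is up to `≈` and in any order, so the elements of `L` are taken out of `L′`
      -- one at a time by `extract`; uniqueness of `L` ensures that the others are still there.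
      ∑-⊆ : ∀ {L L′} → Unique L → L ⊆ L′ → ∑ f L ≼ ∑ f L′
      ∑-⊆ {[]}    {L′} _ _ = ∑-nonneg f-nonneg L′
      ∑-⊆ {x ∷ L} {L′} (x∉L ∷ L!) L⊆L′ =
        let (M , h , k) = extract (L⊆L′ (here ≈-refl))
        in ≼-trans (+-monoʳ-≼ (f x) (∑-⊆ {L} {M} L! λ y∈L →
             k (L⊆L′ (there y∈L)) (All.lookupₛ S (λ e x≉y x≈z → x≉y (≈-trans x≈z (≈-sym e))) x∉L y∈L))) h

      ∑≼sum : ∀ {s L} → f sumsTo s → Unique L → ∑ f L ≼ s
      ∑≼sum {s} {L} h L! = ≼-approx λ ε 0<ε →
        let (M , _ , k)          = partialSums h ε 0<ε
            (N , N! , L⊆N , M⊆N) = union L M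
        in ≼-trans (∑-⊆ L! L⊆N) (≼ˡ (k N N! M⊆N))

      sumsTo-exists : ∀ {g} → (∀ x → f x ≼ g x) → (∀ {L} → Unique L → ∑ g L ≼ 1ℝ) → ∃[ s ] f sumsTo s
      sumsTo-exists {g} f≼g g≤1 =
        let (s , upper , approx) = supremum Q Q-down Q0 Q≤1 in s , summable (conv s upper approx)
        where
        Q : ℚ → Set
        Q q = ∃[ L ] Unique L × fromℚ q ≼ ∑ f L
        -- A partial sum is a real and `Q` contains rationals, so the bound is applied to a rational
        -- ε/2-approximation, lowered by ε/2 to stay below the sum.
        below-upper : ∀ {s} → (∀ {q} → Q q → fromℚ q ≼ s) → ∀ L → Unique L → ∑ f L ≼ s
        below-upper {s} upper L L! = ≼-approx λ ε 0<ε →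
          let (q , near h k) = rational-near (∑ f L) (half-pos 0<ε)
              δ = q ℚ.- ½ ℚ.* ε
          in ≼-linear (+-mono-≼ h (upper (L , L! , ≼-linear {v = ∑ f L} k (λ n → reg₁ q (seq (∑ f L) n) ε))))
               (λ n → reg₂ q (seq (∑ f L) n) (seq s n) ε)
          where
          reg₁ : ∀ q s ε → (s ℚ.+ ½ ℚ.* ε) ℚ.- q ≡ s ℚ.- (q ℚ.- ½ ℚ.* ε)
          reg₁ = solve 3 (λ q s ε → (s :+ con ½ :* ε) :- q := s :- (q :- con ½ :* ε)) refl
          reg₂ : ∀ q s u ε → ((q ℚ.+ ½ ℚ.* ε) ℚ.+ u) ℚ.- (s ℚ.+ (q ℚ.- ½ ℚ.* ε)) ≡ (u ℚ.+ ε) ℚ.- s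
          reg₂ = solve 4 (λ q s u ε → ((q :+ con ½ :* ε) :+ u) :- (s :+ (q :- con ½ :* ε)) := (u :+ ε) :- s) refl
        Q-down : ∀ {p q} → p ℚ.≤ q → Q q → Q p
        Q-down p≤q (L , L! , h) = L , L! , ≼-trans (fromℚ-mono p≤q) h
        Q0 : Q 0ℚ
        Q0 = [] , [] , ≼-refl
        Q≤1 : ∀ q → Q q → q ℚ.≤ 1ℚ
        Q≤1 q (L , L! , h) = fromℚ-cancel (≼-trans h (≼-trans (∑-mono f≼g L) (g≤1 {L} L!)))
        conv : ∀ s → (∀ {q} → Q q → fromℚ q ≼ s) → (∀ ε → 0ℚ ℚ.< ε → ∃[ q ] Q q × s ≼ fromℚ q +ℝ fromℚ ε) →
               ∀ ε → 0ℚ ℚ.< ε → ∃[ L ] Unique L × (∀ L′ → Unique L′ → L ⊆ L′ → Near ε (∑ f L′) s)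
        conv s upper approx ε 0<ε =
             let (q , (L , L! , q≤L) , h) = approx ε 0<ε
             in L , L! , λ L′ L′! L⊆L′ → near
                  (≼-trans (below-upper upper L′ L′!) (≼+ (ℚₚ.<⇒≤ 0<ε)))
                  (≼-trans h (+-monoˡ-≼ (fromℚ ε) (≼-trans q≤L (∑-⊆ {L} {L′} L! L⊆L′))))

≼-cancel : ∀ {x y p q} → x ≼ y → (∀ n → seq x n ≡ p) → (∀ n → seq y n ≡ q) → p ℚ.≤ q
≼-cancel h e e′ = fromℚ-cancel (≼-trans (≼-reflexive (λ n → sym (e n))) (≼-trans h (≼-reflexive e′)))

∑ℚ : ∀ {A : Set} → (A → ℚ) → List A → ℚ
∑ℚ u L = foldr ℚ._+_ 0ℚ (map u L)

fromℚ-∑ : ∀ {A : Set} (u : A → ℚ) L → ∑ (λ x → fromℚ (u x)) L ≐ fromℚ (∑ℚ u L)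
fromℚ-∑ u []      = pointwise λ _ → refl
fromℚ-∑ u (x ∷ L) = pointwise λ n → cong (u x ℚ.+_) (at (fromℚ-∑ u L) n)

∑-mono∈ : ∀ {A : Set} {f g : A → ℝ} L → (∀ x → x ∈ L → f x ≼ g x) → ∑ f L ≼ ∑ g L
∑-mono∈ []      h = ≼-refl
∑-mono∈ (x ∷ L) h = +-mono-≼ (h x (here refl)) (∑-mono∈ L (λ y y∈L → h y (there y∈L)))

limit-squeeze : ∀ {a b} → (∀ t → 0ℝ ≼ a t) → (∀ t → a t ≼ b t) → Limit b 0ℝ → Limit a 0ℝ
limit-squeeze {a} {b} 0≤a a≤b lim ε 0<ε =
  let (N , h) = lim ε 0<ε
  in N , λ t le → near (≼-trans (a≤b t) (≼ˡ (h t le))) (≼-trans (0≤a t) (≼+ {a t} (ℚₚ.<⇒≤ 0<ε)))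

-- Indicators and expectations

module Probability (em : ExcludedMiddle 0ℓ) where
  open Completeness em
  open Classical em

  module _ {Ω : Set} (A : Ω → Set) where

    indicator-true : ∀ ω → A ω → indicator A ω ≡ 1ℚ
    indicator-true ω a with em {A ω}
    ... | yes _ = refl
    ... | no ¬a = ⊥-elim (¬a a)

    indicator-nonneg : ∀ ω → 0ℚ ℚ.≤ indicator A ω
    indicator-nonneg ω with em {A ω}
    ... | yes _ = 0≤1
    ... | no _  = ℚₚ.≤-refl

    indicator≤1 : ∀ ω → indicator A ω ℚ.≤ 1ℚ
    indicator≤1 ω with em {A ω}
    ... | yes _ = ℚₚ.≤-refl
    ... | no _  = 0≤1

    indicator≤ : ∀ {q} ω → 0ℚ ℚ.≤ q → (A ω → 1ℚ ℚ.≤ q) → indicator A ω ℚ.≤ q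
    indicator≤ ω 0≤q h with em {A ω}
    ... | yes a = h a
    ... | no _  = 0≤q

  indicator-mono : ∀ {Ω : Set} (A B : Ω → Set) ω → (A ω → B ω) → indicator A ω ℚ.≤ indicator B ω
  indicator-mono A B ω h = indicator≤ A ω (indicator-nonneg B ω)
    (λ a → ℚₚ.≤-reflexive (sym (indicator-true B ω (h a))))

  ∑-indicator-nonneg : ∀ {I : Set} (A : I → Set) L → 0ℚ ℚ.≤ ∑ℚ (indicator A) L
  ∑-indicator-nonneg A []      = ℚₚ.≤-refl
  ∑-indicator-nonneg A (i ∷ L) = ℚₚ.+-mono-≤ (indicator-nonneg A i) (∑-indicator-nonneg A L)

  -- The union bound, outcome by outcome: one failure already makes the sum of the failure
  -- indicators at least 1.
  all⊎1≤∑ : ∀ {I : Set} (A : I → Set) L →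
            (∀ i → i ∈ L → A i) ⊎ 1ℚ ℚ.≤ ∑ℚ (indicator (λ i → ¬ A i)) L
  all⊎1≤∑ A []      = inj₁ λ _ ()
  all⊎1≤∑ A (i ∷ L) with em {A i} | all⊎1≤∑ A L
  ... | yes a | inj₁ h = inj₁ λ { _ (here refl) → a ; j (there m) → h j m }
  ... | yes a | inj₂ h = inj₂ (ℚₚ.+-mono-≤ (indicator-nonneg (λ i → ¬ A i) i) h)
  ... | no ¬a | _      = inj₂ (ℚₚ.+-mono-≤ (ℚₚ.≤-reflexive (sym (indicator-true (λ i → ¬ A i) i ¬a)))
                           (∑-indicator-nonneg (λ i → ¬ A i) L))

  -- An arbitrary setoid is allowed because this serves both the probability spaces and the limit
  -- distribution on trees, where elements are identified up to isomorphism; hence the congruence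
  -- conditions below.
  module Expectation {S : Setoid 0ℓ 0ℓ} (μ : PMF S) where
    open Setoid S using (Carrier; _≈_)
    open Sums S public

    weight : Carrier → ℝ
    weight = mass μ

    weight-nonneg : ∀ ω → 0ℝ ≼ weight ω
    weight-nonneg ω = ⟨ mass≥0 μ ω ⟩

    weight-cong : ∀ {ω ω′} → ω ≈ ω′ → weight ω ≼ weight ω′
    weight-cong e = ⟨ proj₁ (mass-cong μ e) ⟩

    weight-sum : weight sumsTo 1ℝ
    weight-sum = HasSum⇒sumsTo (mass-sum μ)

    infix 4 _expects_

    record _expects_ (Y : Carrier → ℚ) (e : ℝ) : Set where
      constructor expecting
      field weightedSum : (λ ω → Y ω ·ℝ weight ω) sumsTo e
    open _expects_ public

    term-mono : ∀ (Y Z : Carrier → ℚ) ω → Y ω ℚ.≤ Z ω → Y ω ·ℝ weight ω ≼ Z ω ·ℝ weight ω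
    term-mono Y Z ω h = ·-monoˡ-≼ h (weight-nonneg ω)

    1·≐ : ∀ x → 1ℚ ·ℝ x ≐ x
    1·≐ x = pointwise (λ n → ℚₚ.*-identityˡ (seq x n))

    0≐0· : ∀ x → 0ℝ ≐ 0ℚ ·ℝ x
    0≐0· x = pointwise (λ n → sym (ℚₚ.*-zeroˡ (seq x n)))

    term-nonneg : ∀ (Y : Carrier → ℚ) → (∀ ω → 0ℚ ℚ.≤ Y ω) → ∀ ω → 0ℝ ≼ Y ω ·ℝ weight ω
    term-nonneg Y 0≤Y ω = ≼-trans (≐⇒≼ (0≐0· (weight ω))) (term-mono (λ _ → 0ℚ) Y ω (0≤Y ω))

    Congruent : (Carrier → ℚ) → Set
    Congruent Y = ∀ {ω ω′} → ω ≈ ω′ → Y ω ≡ Y ω′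

    term-cong : ∀ (Y : Carrier → ℚ) → (∀ ω → 0ℚ ℚ.≤ Y ω) → Congruent Y →
                ∀ {ω ω′} → ω ≈ ω′ → Y ω ·ℝ weight ω ≼ Y ω′ ·ℝ weight ω′
    term-cong Y 0≤Y Y-cong {ω} {ω′} e = subst (λ q → Y ω ·ℝ weight ω ≼ q ·ℝ weight ω′) (Y-cong e)
      (·-mono-≼ (0≤Y ω) (weight-cong e))

    expects-exists : ∀ {Y} → Congruent Y → (∀ ω → 0ℚ ℚ.≤ Y ω) → (∀ ω → Y ω ℚ.≤ 1ℚ) → ∃[ e ] Y expects e
    expects-exists {Y} Y-cong 0≤Y Y≤1 = map₂ expecting
      (sumsTo-exists (term-nonneg Y 0≤Y) (term-cong Y 0≤Y Y-cong) {weight}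
      (λ ω → ≼-trans (term-mono Y (λ _ → 1ℚ) ω (Y≤1 ω)) (≐⇒≼ (1·≐ (weight ω))))
      (λ {L} L! → ∑≼sum weight-nonneg weight-cong {L = L} weight-sum L!))

    ∑≼expectation : ∀ {Y e} → Congruent Y → (∀ ω → 0ℚ ℚ.≤ Y ω) → Y expects e →
                    ∀ {L} → Unique L → ∑ (λ ω → Y ω ·ℝ weight ω) L ≼ e
    ∑≼expectation {Y} Y-cong 0≤Y h {L} = ∑≼sum (term-nonneg Y 0≤Y) (term-cong Y 0≤Y Y-cong) {L = L} (weightedSum h)

    indicator·≼ : ∀ (A : Carrier → Set) ω {x} → (A ω → weight ω ≼ x) → 0ℝ ≼ x → indicator A ω ·ℝ weight ω ≼ x
    indicator·≼ A ω h 0≤x with em {A ω}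
    ... | yes a = ≼-trans (≐⇒≼ (1·≐ (weight ω))) (h a)
    ... | no _  = ≼-trans (≐⇒≼ (≐-sym (0≐0· (weight ω)))) 0≤x

    expects-mono : ∀ {Y Z e e′} → (∀ ω → Y ω ℚ.≤ Z ω) → Y expects e → Z expects e′ → e ≼ e′
    expects-mono {Y} {Z} h p q = sumsTo-mono (λ ω → term-mono Y Z ω (h ω)) (weightedSum p) (weightedSum q)

    expects-nonneg : ∀ {Y e} → Congruent Y → (∀ ω → 0ℚ ℚ.≤ Y ω) → Y expects e → 0ℝ ≼ e
    expects-nonneg Y-cong 0≤Y h = ∑≼expectation Y-cong 0≤Y h {L = []} []

    expects-cong : ∀ {Y Z e} → (∀ ω → Y ω ≡ Z ω) → Y expects e → Z expects e
    expects-cong {Y} {Z} {e} Y≡Z (expecting h) = expecting (summable λ ε 0<ε →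
      let (L , L! , k) = partialSums h ε 0<ε
      in L , L! , λ L′ L′! L⊆L′ → near
           (≼-trans (∑-mono (λ ω → term-mono Z Y ω (ℚₚ.≤-reflexive (sym (Y≡Z ω)))) L′) (≼ˡ (k L′ L′! L⊆L′)))
           (≼-trans (≼ʳ (k L′ L′! L⊆L′)) (+-monoˡ-≼ (fromℚ ε)
             (∑-mono (λ ω → term-mono Y Z ω (ℚₚ.≤-reflexive (Y≡Z ω))) L′))))

    expects-+ : ∀ {Y Z e e′} → Y expects e → Z expects e′ → (λ ω → Y ω ℚ.+ Z ω) expects e +ℝ e′
    expects-+ {Y} {Z} (expecting p) (expecting q) = expecting
      (sumsTo-+ {λ ω → Y ω ·ℝ weight ω} {λ ω → Z ω ·ℝ weight ω} {λ ω → (Y ω ℚ.+ Z ω) ·ℝ weight ω}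
        (λ ω → pointwise λ n → ℚₚ.*-distribʳ-+ (seq (weight ω) n) (Y ω) (Z ω)) p q)

    expects-const : ∀ {q} → 0ℚ ℚ.≤ q → (λ _ → q) expects fromℚ q
    expects-const {q} 0≤q = expecting (summable λ ε 0<ε →
      let (L , L! , k) = partialSums (sumsTo-· 0≤q weight-sum) ε 0<ε
      in L , L! , λ L′ L′! L⊆L′ →
           let (near a b) = k L′ L′! L⊆L′
           in near (≼-linear a (λ n → reg₁ (seq (∑ (λ ω → q ·ℝ weight ω) L′) n) ε q))
                (≼-linear b (λ n → reg₂ (seq (∑ (λ ω → q ·ℝ weight ω) L′) n) ε q)))
      where
      reg₁ : ∀ x ε q → (q ℚ.* 1ℚ ℚ.+ ε) ℚ.- x ≡ (q ℚ.+ ε) ℚ.- x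
      reg₁ = solve 3 (λ x ε q → (q :* con 1ℚ :+ ε) :- x := (q :+ ε) :- x) refl
      reg₂ : ∀ x ε q → (x ℚ.+ ε) ℚ.- q ℚ.* 1ℚ ≡ (x ℚ.+ ε) ℚ.- q
      reg₂ = solve 3 (λ x ε q → (x :+ ε) :- q :* con 1ℚ := (x :+ ε) :- q) refl

    expects-∑ : ∀ {A : Set} {Y : A → Carrier → ℚ} {e : A → ℝ} → (∀ a → Y a expects e a) →
                ∀ L → (λ ω → ∑ℚ (λ a → Y a ω) L) expects ∑ e L
    expects-∑ h []      = expects-const ℚₚ.≤-refl
    expects-∑ h (a ∷ L) = expects-+ (h a) (expects-∑ h L)

  -- A finite list carries mass at least 1 - δ, whatever `Y` is. If `Y` is at most 1 and vanishes on
  -- the list, then `Y` plus the indicator of the list is at most 1, which leaves at most δ for `Y`.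
  expects-tight : ∀ (P : ProbabilitySpace) {δ} → 0ℚ ℚ.< δ → let open Expectation (ℙ P) in
    ∃[ L ] (∀ {Y e} → (∀ ω → Y ω ℚ.≤ 1ℚ) → (∀ ω → ω ∈ L → Y ω ≡ 0ℚ) → Y expects e → e ≼ fromℚ δ)
  expects-tight P {δ} 0<δ =
      let (L , L! , k)  = partialSums weight-sum δ 0<δ
          1L            = indicator (_∈ L)
          (s , s-sum)   = expects-exists {1L} (cong 1L) (indicator-nonneg (_∈ L)) (indicator≤1 (_∈ L))
          L≤s           = ∑≼expectation (cong 1L) (indicator-nonneg (_∈ L)) s-sum {L} L!
          m≤1L          = ∑-mono∈ {f = weight} {λ ω → 1L ω ·ℝ weight ω} L λ ω ω∈L → ≼-trans (≐⇒≼ (≐-sym (1·≐ (weight ω))))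
                            (term-mono (λ _ → 1ℚ) 1L ω (ℚₚ.≤-reflexive (sym (indicator-true (_∈ L) ω ω∈L))))
      in L , λ {Y} {e} Y≤1 Y≡0 h →
           ≼-linear (+-mono-≼ (expects-mono (λ ω → Y+1L≤1 L Y ω (Y≤1 ω) (Y≡0 ω)) (expects-+ h s-sum) (expects-const 0≤1))
                       (+-mono-≼ (≼ʳ (k L L! (λ x∈L → x∈L))) (≼-trans m≤1L L≤s)))
             (λ n → solve 4 (λ e s m δ → (con 1ℚ :+ ((m :+ δ) :+ s)) :- ((e :+ s) :+ (con 1ℚ :+ m)) := δ :- e) refl
               (seq e n) (seq s n) (seq (∑ weight L) n) δ)
      where
      open Expectation (ℙ P)
      Y+1L≤1 : ∀ L (Y : Ω P → ℚ) ω → Y ω ℚ.≤ 1ℚ → (ω ∈ L → Y ω ≡ 0ℚ) → Y ω ℚ.+ indicator (_∈ L) ω ℚ.≤ 1ℚ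
      Y+1L≤1 L Y ω Y≤1 Y≡0 with em {ω ∈ L}
      ... | yes ω∈L = ℚₚ.≤-reflexive (trans (cong (ℚ._+ 1ℚ) (Y≡0 ω∈L)) (ℚₚ.+-identityˡ 1ℚ))
      ... | no _    = ℚₚ.≤-trans (ℚₚ.≤-reflexive (ℚₚ.+-identityʳ (Y ω))) Y≤1

  -- Convergence in probability

  module _ (P : ℕ → ProbabilitySpace) where
    open module 𝔼 t = Expectation (ℙ (P t))
      using (_expects_; expects-exists; expects-mono; expects-nonneg; expects-+; expects-const)

    Far : (∀ t → Ω (P t) → ℚ) → ℝ → ℚ → ∀ t → Ω (P t) → Set
    Far Y y δ t ω = ¬ Near δ (fromℚ (Y t ω)) y

    InProbability : (∀ t → Ω (P t) → ℚ) → ℝ → Set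
    InProbability Y y = ∀ δ → 0ℚ ℚ.< δ →
      ∃[ p ] (∀ t → _expects_ t (indicator (Far Y y δ t)) (p t)) × Limit p 0ℝ

    -- Indicators always have an expectation, so a proof of convergence in probability only has to
    -- find an upper bound whose expectation vanishes.
    inProbability-dominated : ∀ {Z : ∀ t → Ω (P t) → ℚ} {q} (A : ∀ t → Ω (P t) → Set) →
      (∀ t ω → indicator (A t) ω ℚ.≤ Z t ω) → (∀ t → _expects_ t (Z t) (q t)) → Limit q 0ℝ →
      ∃[ p ] (∀ t → _expects_ t (indicator (A t)) (p t)) × Limit p 0ℝ
    inProbability-dominated {Z} {q} A h hq lim = (λ t → proj₁ (p t)) , (λ t → proj₂ (p t))
      , limit-squeeze (λ t → expects-nonneg t (cong (indicator (A t))) (indicator-nonneg (A t)) (proj₂ (p t)))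
          (λ t → expects-mono t (h t) (proj₂ (p t)) (hq t)) lim
      where
      p : ∀ t → ∃[ e ] _expects_ t (indicator (A t)) e
      p t = expects-exists t (cong (indicator (A t))) (indicator-nonneg (A t)) (indicator≤1 (A t))

    converges⇒inProbability : ∀ {Y y} → ConvergesInProbability P Y y → InProbability Y y
    converges⇒inProbability {Y} {y} h δ 0<δ =
      let (p , hp , lim) = h (fromℚ δ) (0<fromℚ 0<δ)
          B : ∀ t → Ω (P t) → Set
          B t ω = fromℚ δ ≤ℝ ∣ fromℚ (Y t ω) -ℝ y ∣ℝ
      in inProbability-dominated {λ t → indicator (B t)} {p} (Far Y y δ)
           (λ t ω → indicator-mono (Far Y y δ t) (B t) ω (far⇒≤ t ω))
           (λ t → 𝔼.expecting (𝔼.HasSum⇒sumsTo t (hp t))) (⟶⇒Limit lim)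
      where
      far⇒≤ : ∀ t ω → Far Y y δ t ω → fromℚ δ ≤ℝ ∣ fromℚ (Y t ω) -ℝ y ∣ℝ
      far⇒≤ t ω far with em {fromℚ δ ≼ ∣ fromℚ (Y t ω) -ℝ y ∣ℝ}
      ... | yes h = ≼⇒≤ h
      ... | no h  = ⊥-elim (far (∣-∣≼⇒near (⋠⇒≽ h)))

    inProbability⇒converges : ∀ {Y y} → InProbability Y y → ConvergesInProbability P Y y
    inProbability⇒converges {Y} {y} h ε 0<ε =
      let (δ , 0<δ , near⇒) = near⇒∣-∣< {ε} 0<ε
          (p , hp , lim)    = h δ 0<δ
          B : ∀ t → Ω (P t) → Set
          B t ω = ε ≤ℝ ∣ fromℚ (Y t ω) -ℝ y ∣ℝ
          (p′ , hp′ , lim′) = inProbability-dominated B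
            (λ t ω → indicator-mono (B t) (Far Y y δ t) ω
              (λ b n → <⇒⋠ {∣ fromℚ (Y t ω) -ℝ y ∣ℝ} {ε} (near⇒ n) ⟨ b ⟩)) hp lim
      in p′ , (λ t → 𝔼.sumsTo⇒HasSum t (𝔼.weightedSum (hp′ t))) , Limit⇒⟶ lim′

    inProbability-cong : ∀ {Y Z y} → (∀ t ω → Y t ω ≡ Z t ω) → InProbability Y y → InProbability Z y
    inProbability-cong {Y} {Z} {y} Y≡Z h δ 0<δ =
      let (p , hp , lim) = h δ 0<δ
      in inProbability-dominated (Far Z y δ)
           (λ t ω → indicator-mono (Far Z y δ t) (Far Y y δ t) ω
             (subst (λ q → ¬ Near δ (fromℚ q) y) (sym (Y≡Z t ω)))) hp lim

    -- Off the far event `Y` is within δ of `y`, and on it both lie between 0 and 1, so the far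
    -- event contributes at most its probability.
    boundedConvergence : ∀ {Y y e} → (∀ t ω → 0ℚ ℚ.≤ Y t ω) → (∀ t ω → Y t ω ℚ.≤ 1ℚ) → 0ℝ ≼ y → y ≼ 1ℝ →
      (∀ t → _expects_ t (Y t) (e t)) → InProbability Y y → Limit e y
    boundedConvergence {Y} {y} {e} 0≤Y Y≤1 0≤y y≤1 he conv ε 0<ε =
      let (p , hp , lim) = conv δ 0<δ
          (N , small)    = lim δ 0<δ
      in N , λ t le →
           let hE  = expects-+ t (expects-const t 0≤r) (hp t)
               hE′ = expects-+ t (expects-+ t (he t) (expects-const t 0≤4δ)) (hp t)
               up  = expects-mono t (upper t) (he t) hE
               lo  = expects-mono t (lower t) (expects-const t 0≤r) hE′
           in near
             (≼-linear (+-mono-≼ up (+-mono-≼ (≼ˡ (small t le)) q≤y))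
               (λ n → solve 5 (λ e q p y ε → ((q :+ D ε :+ D ε :+ p) :+ ((con 0ℚ :+ D ε) :+ (y :+ D ε))) :- (e :+ (p :+ q))
                              := (y :+ ε) :- e) refl
                 (seq (e t) n) q (seq (p t) n) (seq y n) ε))
             (≼-linear (+-mono-≼ lo (+-mono-≼ (≼ˡ (small t le)) y≤q))
               (λ n → solve 5 (λ e q p y ε → ((e :+ (D ε :+ D ε :+ D ε :+ D ε) :+ p) :+ ((con 0ℚ :+ D ε) :+ (q :+ D ε))) :- ((q :+ D ε :+ D ε) :+ (p :+ y))
                              := (e :+ ε) :- y) refl
                 (seq (e t) n) q (seq (p t) n) (seq y n) ε))
      where
      D = λ {n} (ε : +-*-Solver.Polynomial n) → con ½ :* (con ½ :* ε)
      δ = ½ ℚ.* (½ ℚ.* ε)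
      0<δ = half-pos (half-pos 0<ε)
      0≤δ = ℚₚ.<⇒≤ 0<δ
      q = proj₁ (rational-near y 0<δ)
      y≤q = ≼ˡ (proj₂ (rational-near y 0<δ))
      q≤y = ≼ʳ (proj₂ (rational-near y 0<δ))
      -- `expects-const` takes a nonnegative rational, so `y` is replaced by `r`, where `q` is
      -- within δ of `y`. The shift by 2δ makes `r` nonnegative and an upper bound of `Y` off the
      -- far event. In either direction the errors add up to 4δ = ε.
      r = q ℚ.+ δ ℚ.+ δ
      4δ = δ ℚ.+ δ ℚ.+ δ ℚ.+ δ
      0≤r : 0ℚ ℚ.≤ r
      0≤r = ℚₚ.≤-trans (≼-cancel (≼-trans 0≤y y≤q) (λ _ → refl) (λ _ → refl)) (x≤x+ε (q ℚ.+ δ) 0≤δ)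
      0≤4δ : 0ℚ ℚ.≤ 4δ
      0≤4δ = ℚₚ.≤-trans 0≤δ (ℚₚ.≤-trans (x≤x+ε δ 0≤δ) (ℚₚ.≤-trans (x≤x+ε (δ ℚ.+ δ) 0≤δ) (x≤x+ε (δ ℚ.+ δ ℚ.+ δ) 0≤δ)))
      module _ t (ω : Ω (P t)) where
        A = Far Y y δ t
        upper : Y t ω ℚ.≤ r ℚ.+ indicator A ω
        upper with em {A ω}
        ... | yes _ = ℚₚ.≤-trans (Y≤1 t ω) (ℚₚ.≤-trans (x≤x+ε 1ℚ 0≤r) (ℚₚ.≤-reflexive (ℚₚ.+-comm 1ℚ r)))
        ... | no ¬far with em {Near δ (fromℚ (Y t ω)) y}
        ...   | no far = ⊥-elim (¬far far)
        ...   | yes (near h _) = ℚₚ.≤-trans (≼-cancel (≼-trans h (+-monoˡ-≼ (fromℚ δ) y≤q)) (λ _ → refl) (λ _ → refl))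
                                   (ℚₚ.≤-reflexive (sym (ℚₚ.+-identityʳ r)))
        lower : r ℚ.≤ Y t ω ℚ.+ 4δ ℚ.+ indicator A ω
        lower with em {A ω}
        ... | yes _ = ℚ-linear
                        (ℚₚ.+-mono-≤ (ℚₚ.+-mono-≤
                            (≼-cancel {p = q} {1ℚ ℚ.+ δ} (≼-trans q≤y (+-monoˡ-≼ (fromℚ δ) y≤1)) (λ _ → refl) (λ _ → refl))
                            0≤δ) (0≤Y t ω))
                        (solve 3 (λ q δ y → (con 1ℚ :+ δ :+ δ :+ y) :- (q :+ con 0ℚ :+ con 0ℚ)
                            := (y :+ (δ :+ δ :+ δ :+ δ) :+ con 1ℚ) :- (q :+ δ :+ δ)) refl q δ (Y t ω))
        ... | no ¬far with em {Near δ (fromℚ (Y t ω)) y}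
        ...   | no far = ⊥-elim (¬far far)
        ...   | yes (near _ h) = ℚ-linear
                        (≼-cancel {p = q} {Y t ω ℚ.+ δ ℚ.+ δ} (≼-trans q≤y (+-monoˡ-≼ (fromℚ δ) h)) (λ _ → refl) (λ _ → refl))
                                   (solve 3 (λ q δ y → (y :+ δ :+ δ) :- q
                                        := (y :+ (δ :+ δ :+ δ :+ δ) :+ con 0ℚ) :- (q :+ δ :+ δ)) refl q δ (Y t ω))

  -- Fractions of nodes

  count : ∀ {V : Set} → (V → Set) → List V → ℕ
  count A L = length (filter (λ v → em {A v}) L)

  module _ {V : Set} {A B C : V → Set} where

    count-⊎ : (∀ v → C v → A v ⊎ B v) → ∀ L → count C L ≤ count A L ℕ.+ count B L
    count-⊎ h [] = z≤n
    count-⊎ h (v ∷ L) with em {A v} | em {B v} | em {C v}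
    ... | yes a | yes b | yes c = s≤s (ℕₚ.≤-trans (count-⊎ h L) (ℕₚ.+-monoʳ-≤ (count A L) (ℕₚ.n≤1+n _)))
    ... | yes a | yes b | no ¬c = ℕₚ.≤-trans (count-⊎ h L) (ℕₚ.+-mono-≤ (ℕₚ.n≤1+n _) (ℕₚ.n≤1+n _))
    ... | yes a | no ¬b | yes c = s≤s (count-⊎ h L)
    ... | yes a | no ¬b | no ¬c = ℕₚ.m≤n⇒m≤1+n (count-⊎ h L)
    ... | no ¬a | yes b | yes c = ℕₚ.≤-trans (s≤s (count-⊎ h L)) (ℕₚ.≤-reflexive (sym (ℕₚ.+-suc _ _)))
    ... | no ¬a | yes b | no ¬c = ℕₚ.≤-trans (count-⊎ h L) (ℕₚ.+-monoʳ-≤ (count A L) (ℕₚ.n≤1+n _))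
    ... | no ¬a | no ¬b | no ¬c = count-⊎ h L
    ... | no ¬a | no ¬b | yes c with h v c
    ...   | inj₁ a = ⊥-elim (¬a a)
    ...   | inj₂ b = ⊥-elim (¬b b)

    count-disjoint : (∀ v → A v → B v → ⊥) → (∀ v → A v → C v) → (∀ v → B v → C v) →
                     ∀ L → count A L ℕ.+ count B L ≤ count C L
    count-disjoint d f g [] = z≤n
    count-disjoint d f g (v ∷ L) with em {A v} | em {B v} | em {C v}
    ... | yes a | yes b | _     = ⊥-elim (d v a b)
    ... | yes a | no ¬b | yes c = s≤s (count-disjoint d f g L)
    ... | no ¬a | yes b | yes c = ℕₚ.≤-trans (ℕₚ.≤-reflexive (ℕₚ.+-suc _ _)) (s≤s (count-disjoint d f g L))
    ... | no ¬a | no ¬b | yes c = ℕₚ.m≤n⇒m≤1+n (count-disjoint d f g L)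
    ... | no ¬a | no ¬b | no ¬c = count-disjoint d f g L
    ... | yes a | no ¬b | no ¬c = ⊥-elim (¬c (f v a))
    ... | no ¬a | yes b | no ¬c = ⊥-elim (¬c (g v b))

  fraction-⊎ : ∀ {t} {A B C : Fin t → Set} → (∀ v → C v → A v ⊎ B v) →
               fraction C ℚ.≤ fraction A ℚ.+ fraction B
  fraction-⊎ {zero}  _ = ℚₚ.≤-refl
  fraction-⊎ {suc d} {A} {B} h = ℚₚ.≤-trans (/-mono d (count-⊎ h (allFin (suc d))))
    (ℚₚ.≤-reflexive (sym (/-+ (count A (allFin (suc d))) (count B (allFin (suc d))) d)))

  fraction-disjoint : ∀ {t} {A B C : Fin t → Set} → (∀ v → A v → B v → ⊥) →
    (∀ v → A v → C v) → (∀ v → B v → C v) → fraction A ℚ.+ fraction B ℚ.≤ fraction C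
  fraction-disjoint {zero}  _ _ _ = ℚₚ.≤-refl
  fraction-disjoint {suc d} {A} {B} h f g = ℚₚ.≤-trans
    (ℚₚ.≤-reflexive (/-+ (count A (allFin (suc d))) (count B (allFin (suc d))) d))
    (/-mono d (count-disjoint h f g (allFin (suc d))))

  fraction-none : ∀ {t} {A : Fin t → Set} → (∀ v → ¬ A v) → fraction A ≡ 0ℚ
  fraction-none {zero}  h = refl
  fraction-none {suc d} {A} h = trans (cong (λ L → + length L / suc d)
    (filter-none (λ v → em {A v}) (All.universal h (allFin (suc d))))) (0/ d)

  fraction-all : ∀ {d} {A : Fin (suc d) → Set} → (∀ v → A v) → fraction A ≡ 1ℚ
  fraction-all {d} {A} h = trans (cong (λ L → + length L / suc d)
    (filter-all (λ v → em {A v}) (All.universal h (allFin (suc d)))))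
    (trans (cong (λ n → + n / suc d) (length-tabulate {n = suc d} (λ v → v))) (n/n d))

  fraction-mono : ∀ {t} {A B : Fin t → Set} → (∀ v → A v → B v) → fraction A ℚ.≤ fraction B
  fraction-mono {t} {A} {B} h = ℚₚ.≤-trans (fraction-⊎ {A = B} {λ _ → ⊥} {A} (λ v a → inj₁ (h v a)))
    (ℚₚ.≤-reflexive (trans (cong (fraction B ℚ.+_) (fraction-none {A = λ (_ : Fin t) → ⊥} (λ _ z → z)))
      (ℚₚ.+-identityʳ (fraction B))))

  fraction-cong : ∀ {t} {A B : Fin t → Set} → (∀ v → A v → B v) → (∀ v → B v → A v) → fraction A ≡ fraction B
  fraction-cong f g = ℚₚ.≤-antisym (fraction-mono f) (fraction-mono g)

  fraction-nonneg : ∀ {t} (A : Fin t → Set) → 0ℚ ℚ.≤ fraction A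
  fraction-nonneg {t} A = subst (ℚ._≤ fraction A)
    (fraction-none {A = λ (_ : Fin t) → ⊥} (λ _ z → z))
    (fraction-mono {A = λ _ → ⊥} {A} λ _ → ⊥-elim)

  fraction≤1 : ∀ {t} (A : Fin t → Set) → fraction A ℚ.≤ 1ℚ
  fraction≤1 {zero}  A = 0≤1
  fraction≤1 {suc d} A = ℚₚ.≤-trans (fraction-mono {A = A} {λ _ → 0 ≡ 0} (λ _ _ → refl))
    (ℚₚ.≤-reflexive (fraction-all {d} {λ _ → 0 ≡ 0} λ _ → refl))

  module _ {t} {I : Set} (A : I → Fin t → Set) where

    fraction-∑-disjoint : ∀ {C} L → AllPairs (λ i j → ∀ v → A i v → A j v → ⊥) L → (∀ i v → A i v → C v) →
      ∑ℚ (λ i → fraction (A i)) L ℚ.≤ fraction C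
    fraction-∑-disjoint {C} L d f = ℚₚ.≤-trans (go L d)
      (fraction-mono {A = λ v → Any (λ i → A i v) L} {C}
        λ v a → let (i , h) = Any.satisfied a in f i v h)
      where
      go : ∀ L → AllPairs (λ i j → ∀ v → A i v → A j v → ⊥) L →
           ∑ℚ (λ i → fraction (A i)) L ℚ.≤ fraction (λ v → Any (λ i → A i v) L)
      go [] _ = fraction-nonneg (λ v → Any (λ i → A i v) [])
      go (i ∷ L) (d ∷ ds) = ℚₚ.≤-trans (ℚₚ.+-monoʳ-≤ (fraction (A i)) (go L ds))
        (fraction-disjoint {A = A i} {λ v → Any (λ i → A i v) L} {λ v → Any (λ i → A i v) (i ∷ L)}
          (λ v a b → let (h , k) = All.lookupAny d b in h v a k) (λ _ → here) (λ _ → there))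

    fraction-∑-cover : ∀ {C} L → (∀ v → C v → Any (λ i → A i v) L) → fraction C ℚ.≤ ∑ℚ (λ i → fraction (A i)) L
    fraction-∑-cover [] h = ℚₚ.≤-reflexive (fraction-none (λ v c → case (h v c)))
      where
      case : ∀ {v} → Any (λ i → A i v) [] → ⊥
      case ()
    fraction-∑-cover (i ∷ L) h = ℚₚ.≤-trans
      (fraction-⊎ {A = A i} {λ v → Any (λ i → A i v) L} λ v c → split (h v c))
      (ℚₚ.+-monoʳ-≤ (fraction (A i)) (fraction-∑-cover L (λ _ a → a)))
      where
      split : ∀ {v} → Any (λ i → A i v) (i ∷ L) → A i v ⊎ Any (λ i → A i v) L
      split (here a)  = inj₁ a
      split (there a) = inj₂ a

-- Convergence on all sets implies tightness

limit-resp : ∀ {a L M} → Limit a L → L ≼ M → M ≼ L → Limit a M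
limit-resp {a} {L} {M} h p q ε 0<ε =
  let (N , k) = h ε 0<ε
  in N , λ t le → near (≼-trans (≼ˡ (k t le)) (+-monoˡ-≼ (fromℚ ε) p)) (≼-trans q (≼ʳ (k t le)))

stepwise-mono : (f : ℕ → ℕ) → (∀ n → f n ≤ f (suc n)) → ∀ {i j} → i ≤ j → f i ≤ f j
stepwise-mono f h {j = zero}  z≤n = ℕₚ.≤-refl
stepwise-mono f h {i} {suc j} le with ℕₚ.m≤n⇒m<n∨m≡n le
... | inj₁ (s≤s le′) = ℕₚ.≤-trans (stepwise-mono f h le′) (h j)
... | inj₂ refl      = ℕₚ.≤-refl

module GlidingHump (em : ExcludedMiddle 0ℓ) where
  open Completeness em

  [_,_⟩ : ℕ → ℕ → ℕ → Set
  [ m , n ⟩ x = m ≤ x × x < n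

  [_,∞⟩ : ℕ → ℕ → Set
  [ m ,∞⟩ x = m ≤ x

  -- `E A t` abstracts the expected fraction of nodes with colour in `A`: at each time a bounded,
  -- finitely additive set function on ℕ with vanishing tails.
  module _ (E : (ℕ → Set) → ℕ → ℝ) (R : (ℕ → Set) → ℝ)
    (limit      : ∀ A → Limit (E A) (R A))
    (E-nonneg   : ∀ A t → 0ℝ ≼ E A t)
    (E≤1        : ∀ A t → E A t ≼ 1ℝ)
    (E-⊎        : ∀ {A B C} t → (∀ n → C n → A n ⊎ B n) → E C t ≼ E A t +ℝ E B t)
    (E-disjoint : ∀ {A B C} t → (∀ n → A n → B n → ⊥) → (∀ n → A n → C n) → (∀ n → B n → C n) →
                  E A t +ℝ E B t ≼ E C t)
    (E-tail     : ∀ t {δ} → 0ℚ ℚ.< δ → ∃[ m ] (∀ n → m ≤ n → E [ n ,∞⟩ t ≼ fromℚ δ))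
    where

    R-nonneg : ∀ A → 0ℝ ≼ R A
    R-nonneg A = limit-mono (limit-const {0ℝ}) (limit A) (0 , λ t _ → E-nonneg A t)

    R≤1 : ∀ A → R A ≼ 1ℝ
    R≤1 A = limit-mono (limit A) (limit-const {1ℝ}) (0 , λ t _ → E≤1 A t)

    R-disjoint : ∀ {A B C} → (∀ n → A n → B n → ⊥) → (∀ n → A n → C n) → (∀ n → B n → C n) →
                 R A +ℝ R B ≼ R C
    R-disjoint {A} {B} {C} d f g = limit-mono (limit-+ {L = R A} {R B} (limit A) (limit B)) (limit C)
      (0 , λ t _ → E-disjoint t d f g)

    -- Since `R` is superadditive and at most 1, intervals of mass at least 1/(d+1) cannot be
    -- stacked for ever. Only bounded intervals are controlled: `R [ m₀ ,∞⟩` may still contain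
    -- escaped mass.
    limit-tail : ∀ d → ∃[ m₀ ] (∀ m → R [ m₀ , m ⟩ ≼ fromℚ (+ 1 / suc d))
    limit-tail d with em {∃[ m₀ ] (∀ m → R [ m₀ , m ⟩ ≼ fromℚ (+ 1 / suc d))}
    ... | yes h = h
    -- The d + 2 disjoint intervals of mass at least 1/(d+1) each would exceed the total of 1.
    ... | no ¬h = ⊥-elim (<⇒≱ (0<1/ d) (1/d≤0 (proj₂ (climb (suc (suc d))))))
      where
      exceed : ∀ m₀ → ∃[ m ] fromℚ (+ 1 / suc d) ≼ R [ m₀ , m ⟩
      exceed m₀ with em {∃[ m ] ¬ R [ m₀ , m ⟩ ≼ fromℚ (+ 1 / suc d)}
      ... | yes (m , h) = m , ⋠⇒≽ h
      ... | no ¬k = ⊥-elim (¬h (m₀ , bounded))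
        where
        bounded : ∀ m → R [ m₀ , m ⟩ ≼ fromℚ (+ 1 / suc d)
        bounded m with em {R [ m₀ , m ⟩ ≼ fromℚ (+ 1 / suc d)}
        ... | yes h = h
        ... | no h  = ⊥-elim (¬k (m , h))
      climb : ∀ j → ∃[ m ] fromℚ (+ j / suc d) ≼ R [ 0 , m ⟩
      climb zero = 0 , ≼-trans (fromℚ-mono (ℚₚ.≤-reflexive (0/ d))) (R-nonneg [ 0 , 0 ⟩)
      climb (suc j) =
        let (m₀ , h) = climb j
            (m , k)  = exceed m₀
        in m₀ ⊔ m , ≼-trans
             (≼-reflexive (λ _ → trans (cong (λ i → + i / suc d) (ℕₚ.+-comm 1 j)) (sym (/-+ j 1 d))))
             (≼-trans (+-mono-≼ h k) (R-disjoint
               (λ x (_ , x<m₀) (m₀≤x , _) → ℕₚ.<⇒≱ x<m₀ m₀≤x)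
               (λ x (_ , x<m₀) → z≤n , ℕₚ.<-≤-trans x<m₀ (ℕₚ.m≤m⊔n m₀ m))
               (λ x (_ , x<m) → z≤n , ℕₚ.<-≤-trans x<m (ℕₚ.m≤n⊔m m₀ m))))
      1/d≤0 : ∀ {m} → fromℚ (+ suc (suc d) / suc d) ≼ R [ 0 , m ⟩ → + 1 / suc d ℚ.≤ 0ℚ
      1/d≤0 {m} h = ℚ-linear (fromℚ-cancel (≼-trans h (R≤1 [ 0 , m ⟩)))
        (trans (cong (λ q → 1ℚ ℚ.- q) (trans (sym (/-+ 1 (suc d) d)) (cong (+ 1 / suc d ℚ.+_) (n/n d))))
          (solve 1 (λ δ → con 1ℚ :- (δ :+ con 1ℚ) := con 0ℚ :- δ) refl (+ 1 / suc d)))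

    -- If mass kept escaping to infinity, choose times T n and consecutive blocks [M n , M (suc n)⟩
    -- such that at time T n almost all of the escaping mass sits in the n-th block.  The union B of
    -- the even blocks then has large mass at even times and small mass at odd times, so E B cannot
    -- converge.
    record Step (ε δ : ℚ) (m₀ n m : ℕ) : Set where
      field
        t m′    : ℕ
        n≤t     : n ≤ t
        m≤m′    : m ≤ m′
        escaped : fromℚ ε ≼ E [ m ,∞⟩ t
        tail    : E [ m′ ,∞⟩ t ≼ fromℚ δ
        settled : E [ m₀ , m ⟩ t ≼ fromℚ δ +ℝ fromℚ δ

    module Blocks {ε δ m₀} (0<δ : 0ℚ ℚ.< δ) (δ≤⅛ε : δ ℚ.≤ ½ ℚ.* (½ ℚ.* (½ ℚ.* ε)))
      (step : ∀ n m → Step ε δ m₀ n m) where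
      M : ℕ → ℕ
      M zero    = m₀
      M (suc n) = Step.m′ (step n (M n))

      T : ℕ → ℕ
      T n = Step.t (step n (M n))

      M-mono : ∀ i j → i ≤ j → M i ≤ M j
      M-mono i j = stepwise-mono M (λ n → Step.m≤m′ (step n (M n)))

      B : ℕ → Set
      B x = ∃[ j ] [ M (j ℕ.+ j) , M (suc (j ℕ.+ j)) ⟩ x

      evenTime : ∀ j → fromℚ ε ≼ E B (T (j ℕ.+ j)) +ℝ fromℚ δ
      evenTime j = ≼-trans (Step.escaped s) (≼-trans (E-⊎ (T n) split) (+-monoʳ-≼ (E B (T n)) (Step.tail s)))
        where
        n = j ℕ.+ j
        s = step n (M n)
        split : ∀ x → M n ≤ x → B x ⊎ M (suc n) ≤ x
        split x Mn≤x with ℕₚ.<-≤-connex x (M (suc n))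
        ... | inj₁ lt = inj₁ (j , Mn≤x , lt)
        ... | inj₂ ge = inj₂ ge

      -- `B` omits block `n`, where the hump sits at this time; the rest of `B` lies before that
      -- block, where the mass is settled, or beyond its end.
      oddTime : ∀ j → E B (T (suc (j ℕ.+ j))) ≼ (fromℚ δ +ℝ fromℚ δ) +ℝ fromℚ δ
      oddTime j = ≼-trans (E-⊎ (T n) split) (+-mono-≼ (Step.settled s) (Step.tail s))
        where
        n = suc (j ℕ.+ j)
        s = step n (M n)
        split : ∀ x → B x → [ m₀ , M n ⟩ x ⊎ M (suc n) ≤ x
        split x (i , ge , lt) = Sum.map
          (λ i≤j → ℕₚ.≤-trans (M-mono 0 (i ℕ.+ i) z≤n) ge
                 , ℕₚ.<-≤-trans lt (M-mono (suc (i ℕ.+ i)) n (s≤s (ℕₚ.+-mono-≤ i≤j i≤j))))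
          (λ j<i → ℕₚ.≤-trans (M-mono (suc n) (i ℕ.+ i)
              (subst (_≤ i ℕ.+ i) (cong suc (ℕₚ.+-suc j j)) (ℕₚ.+-mono-≤ j<i j<i))) ge)
          (ℕₚ.≤-<-connex i j)

      contradiction : ⊥
      contradiction =
        let (N , h) = limit B δ 0<δ
            e  = h (T (N ℕ.+ N)) (ℕₚ.≤-trans (ℕₚ.m≤m+n N N) (Step.n≤t (step (N ℕ.+ N) (M (N ℕ.+ N)))))
            o  = h (T (suc (N ℕ.+ N))) (ℕₚ.≤-trans (ℕₚ.≤-trans (ℕₚ.m≤m+n N N) (ℕₚ.n≤1+n _))
                   (Step.n≤t (step (suc (N ℕ.+ N)) (M (suc (N ℕ.+ N))))))
            x  = E B (T (N ℕ.+ N))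
            y  = E B (T (suc (N ℕ.+ N)))
            sum = +-mono-≼ (+-mono-≼ (evenTime N) (≼ˡ e)) (+-mono-≼ (≼ʳ o) (oddTime N))
            -- One δ comes from `evenTime`, two from the comparison with `R B` and three from
            -- `oddTime`. As 8δ ≤ ε, this leaves 2δ ≤ 0.
            ε≤6δ = ≼-linear {u = fromℚ ε} {fromℚ (δ ℚ.+ δ ℚ.+ δ ℚ.+ δ ℚ.+ δ ℚ.+ δ)} sum (λ n →
              solve 5 (λ ε δ x y r → (((x :+ δ) :+ (r :+ δ)) :+ ((y :+ δ) :+ (δ :+ δ :+ δ))) :- ((ε :+ x) :+ (r :+ y))
                                     := (δ :+ δ :+ δ :+ δ :+ δ :+ δ) :- ε) refl
                ε δ (seq x n) (seq y n) (seq (R B) n))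
        in <⇒≱ (ℚₚ.+-mono-< 0<δ 0<δ) (ℚ-linear (ℚₚ.+-mono-≤ (fromℚ-cancel ε≤6δ)
             (ℚₚ.*-monoˡ-≤-nonNeg (+ 8 / 1) δ≤⅛ε))
             (solve 2 (λ ε δ → ((δ :+ δ :+ δ :+ δ :+ δ :+ δ) :+ con (+ 8 / 1) :* (con ½ :* (con ½ :* (con ½ :* ε))))
                               :- (ε :+ con (+ 8 / 1) :* δ)
                               := (con 0ℚ :+ con 0ℚ) :- (δ :+ δ)) refl ε δ))

    tight : ∀ {ε} → 0ℚ ℚ.< ε → ∃[ m ] ∃[ N ] (∀ t → N ≤ t → E [ m ,∞⟩ t ≼ fromℚ ε)
    tight {ε} 0<ε with em {∃[ m ] ∃[ N ] (∀ t → N ≤ t → E [ m ,∞⟩ t ≼ fromℚ ε)}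
    ... | yes h = h
    ... | no ¬h = ⊥-elim (Blocks.contradiction 0<δ δ≤⅛ε step)
      where
      escapes : ∀ m N → ∃[ t ] N ≤ t × fromℚ ε ≼ E [ m ,∞⟩ t
      escapes m N with em {∃[ t ] N ≤ t × fromℚ ε ≼ E [ m ,∞⟩ t}
      ... | yes h = h
      ... | no ¬k = ⊥-elim (¬h (m , N , bounded))
        where
        bounded : ∀ t → N ≤ t → E [ m ,∞⟩ t ≼ fromℚ ε
        bounded t N≤t with em {E [ m ,∞⟩ t ≼ fromℚ ε}
        ... | yes h = h
        ... | no h  = ⊥-elim (¬k (t , N≤t , ⋠⇒≽ h))

      d = proj₁ (archimedean (half-pos (half-pos (half-pos 0<ε))))
      δ = + 1 / suc d
      δ≤⅛ε : δ ℚ.≤ ½ ℚ.* (½ ℚ.* (½ ℚ.* ε))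
      δ≤⅛ε = proj₂ (archimedean (half-pos (half-pos (half-pos 0<ε))))
      0<δ : 0ℚ ℚ.< δ
      0<δ = 0<1/ d
      m₀ = proj₁ (limit-tail d)

      step : ∀ n m → Step ε δ m₀ n m
      step n m =
        -- The order of the choices matters: `t` is so late that the mass of `[ m₀ , m ⟩` is within
        -- δ of its limit, itself at most δ; the cutoff `m′` comes after `t` because `E-tail` is not
        -- uniform in time.
        let (N , h)       = limit [ m₀ , m ⟩ δ 0<δ
            (t , le , k)  = escapes m (n ⊔ N)
            (m′ , tl)     = E-tail t 0<δ
        in record
          { t = t ; m′ = m ⊔ m′
          ; n≤t     = ℕₚ.m⊔n≤o⇒m≤o n N le
          ; m≤m′    = ℕₚ.m≤m⊔n m m′
          ; escaped = k
          ; tail    = tl (m ⊔ m′) (ℕₚ.m≤n⊔m m m′)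
          ; settled = ≼-trans (≼ˡ (h t (ℕₚ.m⊔n≤o⇒n≤o n N le))) (+-monoˡ-≼ (fromℚ δ) (proj₂ (limit-tail d) m))
          }

-- Fractions of nodes with prescribed colours

module ConvergenceAndConsistency (em : ExcludedMiddle 0ℓ) {X : Set} (ι : X ↣ ℕ) (G : RandomGraphProcess X) where
  open Completeness em
  open Probability em
  open Classical em using (fraction; indicator; ConvergesInProbability; 𝒞-Convergent; Consistent; Remp; c)
  open Colouring ι

  space′ : ℕ → ProbabilitySpace
  space′ t = space (G t)

  Ωₜ : ℕ → Set
  Ωₜ t = Ω (space (G t))

  module 𝔼ₜ t = Expectation (ℙ (space (G t)))

  colourFraction : ℕ → (ℕ → Set) → ∀ t → Ωₜ t → ℚ
  colourFraction k A t ω = fraction (λ v → A (colour k (graph (G t) ω) v))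

  c≡colourFraction : ∀ k t T ω → c G k t T ω ≡ colourFraction k (_≡ code (proj₁ T)) t ω
  c≡colourFraction k t T ω = fraction-cong
    (λ v → ≅⇒code (cr k (graph (G t) ω) v) (proj₁ T)) (λ v → code⇒≅ (cr k (graph (G t) ω) v) (proj₁ T))

  colours-bounded : ∀ k t (L : List (Ωₜ t)) → ∃[ m ] (∀ ω → ω ∈ L → ∀ v → colour k (graph (G t) ω) v < m)
  colours-bounded k t L = suc (max 0 colours) , λ ω ω∈L v →
    s≤s (All.lookup (xs≤max 0 colours)
      (∈-concatMap⁺ coloursOf (lose ω∈L (∈-map⁺ (colour k (graph (G t) ω)) (∈-allFin v)))))
    where
    coloursOf : Ωₜ t → List ℕ
    coloursOf ω = map (colour k (graph (G t) ω)) (allFin t)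
    colours = concatMap coloursOf L

  -- From consistency to convergence

  module Consistent⇒Convergent (k : ℕ) (consistent : Consistent G (suc k)) where

    Y : (ℕ → Set) → ∀ t → Ωₜ t → ℚ
    Y = colourFraction (suc k)

    module Labelling (A : ℕ → Set) where
      f : MPNN X (suc k) Bool
      f = proj₁ (colourFunction k (λ n → does (em {A n})))

      -- Against the constant label `false` the errors of `f` are exactly the nodes with colour in
      -- `A`, so every set of colours occurs as a risk.
      f* : NodeLabeling X Bool
      f* _ _ = false

      f*-expressible : Expressible (suc k) f*
      f*-expressible = proj₁ (colourFunction k (λ _ → false)) , λ H v → sym (proj₂ (colourFunction k (λ _ → false)) H v)

      Remp≡Y : ∀ t ω → Remp G f* f t ω ≡ Y A t ω
      Remp≡Y t ω = fraction-cong
        (λ v h → does-true λ e → h (trans (proj₂ (colourFunction k (λ n → does (em {A n}))) (graph (G t) ω) v) e))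
        (λ v a e → true≢false (trans (sym (dec-true em a))
          (trans (sym (proj₂ (colourFunction k (λ n → does (em {A n}))) (graph (G t) ω) v)) e)))
        where
        does-true : ∀ {n} → ¬ does (em {A n}) ≡ false → A n
        does-true {n} h with em {A n}
        ... | yes a = a
        ... | no _  = ⊥-elim (h refl)
        true≢false : true ≡ false → ⊥
        true≢false ()

      consistency = consistent f* f*-expressible f

    R : (ℕ → Set) → ℝ
    R A = proj₁ (Labelling.consistency A)

    E : (ℕ → Set) → ℕ → ℝ
    E A = proj₁ (proj₁ (proj₂ (Labelling.consistency A)))

    E-expects : ∀ A t → 𝔼ₜ._expects_ t (Y A t) (E A t)
    E-expects A t = 𝔼ₜ.expects-cong t (Labelling.Remp≡Y A t)
      (𝔼ₜ.expecting (𝔼ₜ.HasSum⇒sumsTo t (proj₁ (proj₂ (proj₁ (proj₂ (Labelling.consistency A)))) t)))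

    E-limit : ∀ A → Limit (E A) (R A)
    E-limit A = ⟶⇒Limit (proj₂ (proj₂ (proj₁ (proj₂ (Labelling.consistency A)))))

    Y-converges : ∀ A → InProbability space′ (Y A) (R A)
    Y-converges A = inProbability-cong space′ {Remp G (Labelling.f* A) (Labelling.f A)} {Y A} {R A} (Labelling.Remp≡Y A)
      (converges⇒inProbability space′ {Remp G (Labelling.f* A) (Labelling.f A)} {R A}
        (proj₂ (proj₂ (Labelling.consistency A))))

    E-nonneg : ∀ A t → 0ℝ ≼ E A t
    E-nonneg A t = 𝔼ₜ.expects-nonneg t (cong (Y A t)) (λ ω → fraction-nonneg {t} _) (E-expects A t)

    E≤1 : ∀ A t → E A t ≼ 1ℝ
    E≤1 A t = 𝔼ₜ.expects-mono t (λ ω → fraction≤1 {t} _) (E-expects A t) (𝔼ₜ.expects-const t 0≤1)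

    E-⊎ : ∀ {A B C} t → (∀ n → C n → A n ⊎ B n) → E C t ≼ E A t +ℝ E B t
    E-⊎ {A} {B} {C} t h = 𝔼ₜ.expects-mono t (λ ω → fraction-⊎ {t} (λ v → h _)) (E-expects C t)
      (𝔼ₜ.expects-+ t (E-expects A t) (E-expects B t))

    E-disjoint : ∀ {A B C} t → (∀ n → A n → B n → ⊥) → (∀ n → A n → C n) → (∀ n → B n → C n) →
                 E A t +ℝ E B t ≼ E C t
    E-disjoint {A} {B} {C} t d f g = 𝔼ₜ.expects-mono t (λ ω → fraction-disjoint {t} (λ v → d _) (λ v → f _) (λ v → g _))
      (𝔼ₜ.expects-+ t (E-expects A t) (E-expects B t)) (E-expects C t)

    open GlidingHump em

    -- Up to probability δ there are finitely many outcomes at time `t`, each a finite graph, so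
    -- their colours are bounded.
    E-tail : ∀ t {δ} → 0ℚ ℚ.< δ → ∃[ m ] (∀ n → m ≤ n → E [ n ,∞⟩ t ≼ fromℚ δ)
    E-tail t 0<δ =
      let (L , small) = expects-tight (space (G t)) 0<δ
          (m , bound) = colours-bounded (suc k) t L
      in m , λ n m≤n → small (λ ω → fraction≤1 {t} _)
           (λ ω ω∈L → fraction-none {t} λ v n≤v → ℕₚ.<⇒≱ (bound ω ω∈L v) (ℕₚ.≤-trans m≤n n≤v))
           (E-expects [ n ,∞⟩ t)

    E-tight : ∀ {ε} → 0ℚ ℚ.< ε → ∃[ m ] ∃[ N ] (∀ t → N ≤ t → E [ m ,∞⟩ t ≼ fromℚ ε)
    E-tight = tight E R E-limit E-nonneg E≤1 E-⊎ E-disjoint E-tail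

    Trees : Setoid 0ℓ 0ℓ
    Trees = 𝒞 X (suc k)

    open Setoid Trees using () renaming (Carrier to Treeₖ)
    open Sums Trees

    treeCode : Treeₖ → ℕ
    treeCode T = code (proj₁ T)

    limitMass : Treeₖ → ℝ
    limitMass T = R (_≡ treeCode T)

    -- Not every number is the code of a tree in `Trees`, so excluded middle decides for each one;
    -- by `code⇒≅` one representative per code exhausts its class.
    treesBelow : ∀ m → ∃[ L ] Unique L × All (λ T → treeCode T < m) L × (∀ T → treeCode T < m → T ∈ˢ L)
    treesBelow zero = [] , [] , [] , λ _ ()
    treesBelow (suc m) with treesBelow m | em {∃ λ T → treeCode T ≡ m}
    ... | L , L! , L<m , cover | no none = L , L! , All.map ℕₚ.m<n⇒m<1+n L<m , λ T lt →
      cover T (ℕₚ.≤∧≢⇒< (ℕₚ.≤-pred lt) (λ e → none (T , e)))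
    ... | L , L! , L<m , cover | yes (U , refl) =
        U ∷ L
      , All.map (λ {T} T<m U≅T → ℕₚ.<⇒≢ T<m (sym (≅⇒code (proj₁ U) (proj₁ T) U≅T))) L<m ∷ L!
      , ℕₚ.≤-refl ∷ All.map ℕₚ.m<n⇒m<1+n L<m
      , λ T lt → include T (ℕₚ.m≤n⇒m<n∨m≡n (ℕₚ.≤-pred lt))
      where
      include : ∀ T → treeCode T < treeCode U ⊎ treeCode T ≡ treeCode U → T ∈ˢ (U ∷ L)
      include T (inj₁ lt) = there (cover T lt)
      include T (inj₂ e)  = here (code⇒≅ (proj₁ T) (proj₁ U) e)

    module _ (L : List Treeₖ) where

      E-∑ : ∀ t → 𝔼ₜ._expects_ t (λ ω → ∑ℚ (λ T → Y (_≡ treeCode T) t ω) L) (∑ (λ T → E (_≡ treeCode T) t) L)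
      E-∑ t = 𝔼ₜ.expects-∑ t {Y = λ T → Y (_≡ treeCode T) t} {λ T → E (_≡ treeCode T) t}
          (λ T → E-expects (_≡ treeCode T) t) L

      ∑-limit : Limit (λ t → ∑ (λ T → E (_≡ treeCode T) t) L) (∑ limitMass L)
      ∑-limit = limit-∑ {a = λ T → E (_≡ treeCode T)} {limitMass} (λ T → E-limit (_≡ treeCode T)) L

      limitMass≤1 : Unique L → ∑ limitMass L ≼ 1ℝ
      limitMass≤1 L! = limit-mono ∑-limit (limit-const {1ℝ}) (0 , λ t _ →
        𝔼ₜ.expects-mono t (λ ω → ℚₚ.≤-trans
            (fraction-∑-disjoint (λ T v → colour (suc k) (graph (G t) ω) v ≡ treeCode T) {λ _ → ⊤} L
              (AllPairs.map (λ {T} {U} T≇U v e e′ → T≇U (code⇒≅ (proj₁ T) (proj₁ U) (trans (sym e) e′))) L!)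
              (λ _ _ _ → tt))
            (fraction≤1 {t} _))
          (E-∑ t) (𝔼ₜ.expects-const t 0≤1))

      -- At a positive time every node has a tree in `L` or a colour from `m` on. This passes to the
      -- limit because `L` is finite and the tail bound is uniform in late times.
      limitMass-covers : ∀ {m N ε} → (∀ t → N ≤ t → E [ m ,∞⟩ t ≼ fromℚ ε) →
        (∀ T → treeCode T < m → T ∈ˢ L) → 1ℝ ≼ ∑ limitMass L +ℝ fromℚ ε
      limitMass-covers {m} {N} {ε} small cover = limit-mono (limit-const {1ℝ})
        (limit-+ {L = ∑ limitMass L} {fromℚ ε} ∑-limit (limit-const {fromℚ ε}))
        -- Starting at `suc N` avoids time 0, where every fraction is 0 by convention.
        (suc N , λ { (suc t) (s≤s N≤t) → ≼-trans
          (𝔼ₜ.expects-mono (suc t) (covers t) (𝔼ₜ.expects-const (suc t) 0≤1)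
            (𝔼ₜ.expects-+ (suc t) (E-∑ (suc t)) (E-expects [ m ,∞⟩ (suc t))))
          (+-monoʳ-≼ (∑ (λ T → E (_≡ treeCode T) (suc t)) L) (small (suc t) (ℕₚ.m≤n⇒m≤1+n N≤t))) })
        where
        covers : ∀ t ω → 1ℚ ℚ.≤ ∑ℚ (λ T → Y (_≡ treeCode T) (suc t) ω) L ℚ.+ Y [ m ,∞⟩ (suc t) ω
        covers t ω = ℚₚ.≤-trans (ℚₚ.≤-reflexive (sym (fraction-all {t} {λ _ → ⊤} (λ _ → tt))))
          (ℚₚ.≤-trans (fraction-⊎ {suc t} {λ v → col v < m} {λ v → m ≤ col v} {λ _ → ⊤} (λ v _ → ℕₚ.<-≤-connex (col v) m))
            (ℚₚ.+-monoˡ-≤ (Y [ m ,∞⟩ (suc t) ω) (fraction-∑-cover (λ T v → col v ≡ treeCode T) L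
              (λ v lt → Any.map (λ {T} e → ≅⇒code (cr (suc k) H v) (proj₁ T) e)
                (cover (cr (suc k) H v , suc t , H , v , refl) lt)))))
          where
          H = graph (G (suc t)) ω
          col = colour (suc k) H

    limitPMF : PMF Trees
    limitPMF = record
      { mass      = limitMass
      ; mass-cong = λ {T} {U} e →
          ≼⇒≤ (mass-≼ (≅⇒code (proj₁ T) (proj₁ U) e)) , ≼⇒≤ (mass-≼ (sym (≅⇒code (proj₁ T) (proj₁ U) e)))
      ; mass≥0    = λ T → ≼⇒≤ (limit-mono (limit-const {0ℝ}) (E-limit (_≡ treeCode T))
          (0 , λ t _ → E-nonneg (_≡ treeCode T) t))
      ; mass-sum  = sumsTo⇒HasSum (summable λ ε 0<ε →
          let (m , N , small)      = E-tight 0<ε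
              (L , L! , _ , cover) = treesBelow m
          in L , L! , λ L′ L′! L⊆L′ → near
               (≼-trans (limitMass≤1 L′ L′!) (≼+ {1ℝ} (ℚₚ.<⇒≤ 0<ε)))
               (limitMass-covers L′ small (λ T lt → L⊆L′ {T} (cover T lt))))
      }
      where
      mass-≼ : ∀ {m n} → m ≡ n → R (_≡ m) ≼ R (_≡ n)
      mass-≼ refl = ≼-refl

    convergent : 𝒞-Convergent G (suc k)
    convergent = limitPMF , λ T → inProbability⇒converges space′ {λ t → c G (suc k) t T} {limitMass T}
      (inProbability-cong space′ {Y (_≡ treeCode T)} {λ t → c G (suc k) t T} {limitMass T}
        (λ t ω → sym (c≡colourFraction (suc k) t T ω))
        (Y-converges (_≡ treeCode T)))

  -- From convergence to consistency

  module Convergent⇒Consistent (k : ℕ) (convergent : 𝒞-Convergent G k) where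

    c∞ : PMF (𝒞 X k)
    c∞ = proj₁ convergent

    open Setoid (𝒞 X k) using () renaming (Carrier to Treeₖ)
    open Expectation c∞

    c-converges : ∀ T → InProbability space′ (λ t → c G k t T) (weight T)
    c-converges T = converges⇒inProbability space′ {λ t → c G k t T} {weight T} (proj₂ convergent T)

    module _ {A : Set} (f* : NodeLabeling X A) (f*-expressible : Expressible k f*) (f : MPNN X k A) where

      -- Agreements and errors are treated alike, since a lower bound for the fraction of the one is
      -- an upper bound for the other.
      Good : Bool → ∀ {t} → Graph X t → Fin t → Set
      Good true  H v = eval f H v ≡ f* H v
      Good false H v = ¬ eval f H v ≡ f* H v

      -- An element of `Treeₖ` comes with a graph and a node realising it, and goodness is read off
      -- there; `goodTree-cong` makes this independent of the realisation.
      GoodTree : Bool → Treeₖ → Set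
      GoodTree b (_ , _ , H , v , _) = Good b H v

      agreement-invariant : ∀ {t u} (H : Graph X t) (K : Graph X u) v w → colour k H v ≡ colour k K w →
        eval f H v ≡ f* H v → eval f K w ≡ f* K w
      agreement-invariant H K v w e h = trans (sym (eval-colour f v w e)) (trans h
        (trans (proj₂ f*-expressible H v)
          (trans (eval-colour (proj₁ f*-expressible) v w e) (sym (proj₂ f*-expressible K w)))))

      good-invariant : ∀ b {t u} (H : Graph X t) (K : Graph X u) v w → colour k H v ≡ colour k K w →
        Good b H v → Good b K w
      good-invariant true  H K v w e h    = agreement-invariant H K v w e h
      good-invariant false H K v w e h h′ = h (agreement-invariant K H w v (sym e) h′)

      goodFraction : Bool → ∀ t → Ωₜ t → ℚ
      goodFraction b t ω = fraction (Good b (graph (G t) ω))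

      representative : ∀ (T : Treeₖ) → code (proj₁ T) ≡
                       colour k (proj₁ (proj₂ (proj₂ T))) (proj₁ (proj₂ (proj₂ (proj₂ T))))
      representative (_ , _ , _ , _ , refl) = refl

      goodTree-cong : ∀ b {T U} → proj₁ T ≅ proj₁ U → GoodTree b T → GoodTree b U
      goodTree-cong b {T} {U} e = good-invariant b _ _ _ _
        (trans (sym (representative T)) (trans (≅⇒code (proj₁ T) (proj₁ U) e) (representative U)))

      indicator-congruent : ∀ b → Congruent (indicator (GoodTree b))
      indicator-congruent b {T} {U} e = ℚₚ.≤-antisym
        (indicator-mono (λ _ → GoodTree b T) (λ _ → GoodTree b U) T (goodTree-cong b {T} {U} e))
        (indicator-mono (λ _ → GoodTree b U) (λ _ → GoodTree b T) T (goodTree-cong b {U} {T} (≅-sym e)))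

      goodMass : ∀ b → ∃[ r ] indicator (GoodTree b) expects r
      goodMass b = expects-exists (λ {T} {U} → indicator-congruent b {T} {U})
        (indicator-nonneg (GoodTree b)) (indicator≤1 (GoodTree b))

      r : Bool → ℝ
      r b = proj₁ (goodMass b)

      r-nonneg : ∀ b → 0ℝ ≼ r b
      r-nonneg b = expects-nonneg (λ {T} {U} → indicator-congruent b {T} {U})
        (indicator-nonneg (GoodTree b)) (proj₂ (goodMass b))

      r≤1 : ∀ b → r b ≼ 1ℝ
      r≤1 b = expects-mono (indicator≤1 (GoodTree b)) (proj₂ (goodMass b)) (expects-const 0≤1)

      -- Here the total mass 1 of `c∞` enters; it turns the lower bound for agreements into an upper
      -- bound for errors that matches `R`.
      1≼r+r : 1ℝ ≼ r true +ℝ r false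
      1≼r+r = expects-mono total (expects-const 0≤1) (expects-+ (proj₂ (goodMass true)) (proj₂ (goodMass false)))
        where
        total : ∀ T → 1ℚ ℚ.≤ indicator (GoodTree true) T ℚ.+ indicator (GoodTree false) T
        total T with em {GoodTree true T}
        ... | yes g = x≤x+ε 1ℚ (indicator-nonneg (GoodTree false) T)
        ... | no ¬g = ℚₚ.≤-reflexive (sym (trans (ℚₚ.+-identityˡ _) (indicator-true (GoodTree false) T ¬g)))

      Close : ℚ → ∀ t → Ωₜ t → Treeₖ → Set
      Close η t ω T = Near η (fromℚ (c G k t T ω)) (weight T)

      goodTerm : Bool → Treeₖ → ℝ
      goodTerm b T = indicator (GoodTree b) T ·ℝ weight T

      -- Empty for a tree that is not good, so that a sum over all of `L` counts only good nodes,
      -- each at most once.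
      goodNodesOf : Bool → ∀ t → Ωₜ t → Treeₖ → Fin t → Set
      goodNodesOf b t ω T v = cr k (graph (G t) ω) v ≅ proj₁ T × GoodTree b T

      goodNodesOf-∑ : ∀ b t ω {L} → Unique L →
        ∑ (λ T → fromℚ (fraction (goodNodesOf b t ω T))) L ≼ fromℚ (goodFraction b t ω)
      goodNodesOf-∑ b t ω {L} L! = ≼-trans (≐⇒≼ (fromℚ-∑ (λ T → fraction (goodNodesOf b t ω T)) L)) (fromℚ-mono
        (fraction-∑-disjoint (goodNodesOf b t ω) {Good b H} L
          (AllPairs.map (λ T≇U v (e , _) (e′ , _) → T≇U (≅-trans (≅-sym e) e′)) L!)
          (λ T v (e , h) → good-invariant b _ H _ v
            (trans (sym (representative T)) (sym (≅⇒code (cr k H v) (proj₁ T) e))) h)))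
        where H = graph (G t) ω

      goodTerm≼ : ∀ b t ω T {η} → 0ℚ ℚ.< η → Close η t ω T →
        goodTerm b T ≼ fromℚ (fraction (goodNodesOf b t ω T)) +ℝ fromℚ η
      goodTerm≼ b t ω T {η} 0<η close = indicator·≼ (GoodTree b) T
        (λ h → ≼-trans (≼ʳ close) (+-monoˡ-≼ (fromℚ η) (fromℚ-mono (fraction-mono {t} (λ v e → e , h)))))
        (≼-trans (fromℚ-mono (fraction-nonneg (goodNodesOf b t ω T)))
          (≼+ {fromℚ (fraction (goodNodesOf b t ω T))} (ℚₚ.<⇒≤ 0<η)))

      -- Finitely many trees carry almost all of the mass of the good trees, and the nodes
      -- of these trees are good, so c can only underestimate the fraction of good nodes.
      goodFraction-lower : ∀ b {δ} → 0ℚ ℚ.< δ → ∃[ L ] ∃[ η ] 0ℚ ℚ.< η ×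
        (∀ t ω → (∀ T → T ∈ L → Close η t ω T) → r b ≼ fromℚ (goodFraction b t ω) +ℝ fromℚ δ)
      goodFraction-lower b {δ} 0<δ =
        let (L , L! , approx)      = partialSums (weightedSum (proj₂ (goodMass b))) (½ ℚ.* δ) (half-pos 0<δ)
            (η , 0<η , perturb)    = ∑-perturb L (half-pos 0<δ)
        in L , η , 0<η , λ t ω close →
             let g = λ T → fromℚ (fraction (goodNodesOf b t ω T))
             in ≼-linear
                  (+-mono-≼ (≼ʳ (approx L L! (λ x∈L → x∈L)))
                    (+-mono-≼ (perturb (goodTerm b) g (λ T T∈L → goodTerm≼ b t ω T 0<η (close T T∈L)))
                      (goodNodesOf-∑ b t ω {L} L!)))
                  (λ n → solve 5 (λ r x y z δ → ((x :+ con ½ :* δ) :+ ((y :+ con ½ :* δ) :+ z)) :- (r :+ (x :+ y))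
                                 := (z :+ δ) :- r) refl
                    (seq (r b) n) (seq (∑ (goodTerm b) L) n) (seq (∑ g L) n) (goodFraction b t ω) δ)

      R : ℝ
      R = r false

      Y : ∀ t → Ωₜ t → ℚ
      Y = Remp G f* f

      FarTree : ℚ → ∀ t → Treeₖ → Ωₜ t → Set
      FarTree η t T ω = ¬ Close η t ω T

      unionBound : ∀ {η} → 0ℚ ℚ.< η → ∀ L → ∃[ q ]
        (∀ t → 𝔼ₜ._expects_ t (λ ω → ∑ℚ (λ T → indicator (FarTree η t T) ω) L) (q t)) × Limit q 0ℝ
      unionBound {η} 0<η L = (λ t → ∑ (λ T → p T t) L)
        , (λ t → 𝔼ₜ.expects-∑ t {Y = λ T → indicator (FarTree η t T)} {λ T → p T t}
            (λ T → proj₁ (proj₂ (c-converges T η 0<η)) t) L)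
        , limit-resp (limit-∑ {a = p} {λ _ → 0ℝ} (λ T → proj₂ (proj₂ (c-converges T η 0<η))) L)
            (∑0≼0 L) (∑-nonneg (λ _ → ≼-refl) L)
        where
        p : Treeₖ → ℕ → ℝ
        p T = proj₁ (c-converges T η 0<η)
        ∑0≼0 : ∀ L → ∑ (λ (_ : Treeₖ) → 0ℝ) L ≼ 0ℝ
        ∑0≼0 []      = ≼-refl
        ∑0≼0 (_ ∷ L) = ≼-trans (+-monoʳ-≼ 0ℝ (∑0≼0 L)) (≼-reflexive (λ _ → refl))

      Y-converges : InProbability space′ Y R
      Y-converges δ 0<δ =
        let (L₁ , η₁ , 0<η₁ , lower₁) = goodFraction-lower true 0<δ
            (L₂ , η₂ , 0<η₂ , lower₂) = goodFraction-lower false 0<δ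
            (q₁ , hq₁ , lim₁)         = unionBound 0<η₁ L₁
            (q₂ , hq₂ , lim₂)         = unionBound 0<η₂ L₂
        in inProbability-dominated space′ (Far space′ Y R δ)
             (λ t ω → indicator≤ (Far space′ Y R δ t) ω
               (ℚₚ.+-mono-≤ (∑-indicator-nonneg (λ T → FarTree η₁ t T ω) L₁)
                 (∑-indicator-nonneg (λ T → FarTree η₂ t T ω) L₂))
               (covered η₁ L₁ lower₁ η₂ L₂ lower₂ t ω))
             (λ t → 𝔼ₜ.expects-+ t (hq₁ t) (hq₂ t))
             (limit-resp (limit-+ {L = 0ℝ} {0ℝ} lim₁ lim₂) (≼-reflexive (λ _ → refl)) (≼-reflexive (λ _ → refl)))
        where
        Lower : Bool → ℚ → List Treeₖ → Set
        Lower b η L = ∀ t ω → (∀ T → T ∈ L → Close η t ω T) → r b ≼ fromℚ (goodFraction b t ω) +ℝ fromℚ δ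
        complement : ∀ t ω → goodFraction true t ω ℚ.+ Y t ω ℚ.≤ 1ℚ
        complement t ω = ℚₚ.≤-trans
          (fraction-disjoint {t} {C = λ _ → ⊤} (λ v h h′ → h′ h) (λ _ _ → tt) (λ _ _ → tt))
          (fraction≤1 {t} _)
        -- If all trees of both lists were close, both lower bounds would hold and `Y` would be near
        -- `R`; so on the far event some tree is far.
        covered : ∀ η₁ L₁ → Lower true η₁ L₁ → ∀ η₂ L₂ → Lower false η₂ L₂ → ∀ t ω → Far space′ Y R δ t ω →
          1ℚ ℚ.≤ ∑ℚ (λ T → indicator (FarTree η₁ t T) ω) L₁ ℚ.+ ∑ℚ (λ T → indicator (FarTree η₂ t T) ω) L₂
        covered η₁ L₁ lower₁ η₂ L₂ lower₂ t ω far = [ (λ h₁ → [ (λ h₂ → ⊥-elim (far (near (upper h₁) (lower₂ t ω h₂))))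
            , (λ h → ℚₚ.+-mono-≤ (∑-indicator-nonneg (λ T → FarTree η₁ t T ω) L₁) h) ]′ (all⊎1≤∑ (Close η₂ t ω) L₂))
          , (λ h → ℚₚ.+-mono-≤ h (∑-indicator-nonneg (λ T → FarTree η₂ t T ω) L₂)) ]′ (all⊎1≤∑ (Close η₁ t ω) L₁)
          where
          upper : (∀ T → T ∈ L₁ → Close η₁ t ω T) → fromℚ (Y t ω) ≼ R +ℝ fromℚ δ
          -- Errors are at most 1 minus agreements, agreements are at least `r true` - δ, and 1 is
          -- at most `r true` + `R`.
          upper h₁ = ≼-linear (+-mono-≼ (fromℚ-mono (complement t ω)) (+-mono-≼ 1≼r+r (lower₁ t ω h₁)))
            (λ n → solve 5 (λ g y r r′ δ → (con 1ℚ :+ ((r :+ r′) :+ (g :+ δ))) :- ((g :+ y) :+ (con 1ℚ :+ r))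
                           := (r′ :+ δ) :- y) refl
              (goodFraction true t ω) (Y t ω) (seq (r true) n) (seq R n) δ)

      expectation : ∀ t → ∃[ e ] 𝔼ₜ._expects_ t (Y t) e
      expectation t = 𝔼ₜ.expects-exists t (cong (Y t)) (λ ω → fraction-nonneg {t} _) (λ ω → fraction≤1 {t} _)

      consistency : ∃[ R ] (∃[ E ] (∀ t → IsExpectation (space (G t)) (Y t) (E t)) × E ⟶ R) ×
                    ConvergesInProbability space′ Y R
      consistency = R
        , ((λ t → proj₁ (expectation t)) , (λ t → 𝔼ₜ.sumsTo⇒HasSum t (𝔼ₜ.weightedSum (proj₂ (expectation t))))
          , Limit⇒⟶ (boundedConvergence space′ {Y} {R} (λ t ω → fraction-nonneg {t} _) (λ t ω → fraction≤1 {t} _)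
              (r-nonneg false) (r≤1 false) (λ t → proj₂ (expectation t)) Y-converges))
        , inProbability⇒converges space′ {Y} {R} Y-converges

    consistent : Consistent G k
    consistent = consistency

theorem3p6 : (em : ExcludedMiddle 0ℓ) →
    (X : Set) → X ↣ ℕ →
    (k : ℕ) → 1 ≤ k →
    (G : RandomGraphProcess X) →
    Classical.𝒞-Convergent em G k ⇔ Classical.Consistent em G k
theorem3p6 em X ι (suc k) (s≤s z≤n) G = mk⇔
  (ConvergenceAndConsistency.Convergent⇒Consistent.consistent em ι G (suc k))
  (ConvergenceAndConsistency.Consistent⇒Convergent.convergent em ι G k)
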